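{- Reciprocal forms correspond to reciprocal çarks: a çark $\mathcal{C}$ is reciprocal (that is, $\mathcal{C}$ and $(\mathcal{C}^{m})^{r}$ are isomorphic as çarks) if and only if the class of binary quadratic forms represented by $\mathcal{C}$ contains a reciprocal form.
   Context: Let $S(z)=-1/z$, $R(z)=(z-1)/z$. The bipartite Farey tree $\mathcal{F}$ has edges $\{W\}$, $\otimes$-vertices $\{W,WS\}$, $\bullet$-vertices $\{W,WR,WR^2\}$ ($W\in\mathrm{PSL}_2(\mathbf{Z})$); the edge $\{W\}$ joins $\{W,WS\}$ to $\{W,WR,WR^2\}$. $\mathrm{PSL}_2(\mathbf{Z})$ acts on it by left multiplication. $\mathcal{F}$ is realized in the upper half plane $\mathcal{H}$ as the orbit of the geodesic arc from $i$ (the vertex $\{I,S\}$) to $e^{i\pi/3}$ (the vertex $\{I,R,R^2\}$). A çark is $\langle M\rangle\backslash\mathcal{F}$ with $M\in \mathrm{PSL}_2(\mathbf{Z})$ hyperbolic, embedded in the annulus $\langle M\rangle\backslash\mathcal{H}$; its unique circuit, the image of the axis of $M$ in $\mathcal{F}$, is the spine, directed by the translation direction of $M$. The annulus is viewed, compatibly with orientation, as a round annulus in the plane with the spine running counterclockwise, so the inner boundary is to the left of the directed spine. All çarks here are considered with this convention, and isomorphisms of çarks preserve the ribbon structure and the direction of the spine (hence inner and outer boundary). At each $\bullet$-vertex of the spine an infinite Farey branch is attached, going to the inner or the outer boundary. A çark is thus determined by the cyclic word in the letters "inner", "outer" read along the counterclockwise spine. $\mathcal{C}^r$ is the mirror image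 of $\mathcal{C}$ about a line through the centre of the spine: the cyclic word is reversed and inner/outer are kept. $\mathcal{C}^m$ is the reflection of $\mathcal{C}$ with respect to the spine: inner and outer are swapped and the order is kept. In both cases the spine is again directed counterclockwise. $\mathcal{C}$ is reciprocal if $\mathcal{C}\cong(\mathcal{C}^m)^r$. Forms: $(A,B,C)$ denotes $Ax^2+Bxy+Cy^2$ with $A,B,C\in\mathbf{Z}$, and $\mathrm{PSL}_2(\mathbf{Z})$ acts by $(U\cdot f)(x,y)=f(U(x,y)^t)$; classes are orbits. For hyperbolic $M=\begin{pmatrix}p&q\\ r&s\end{pmatrix}$ put $f_M=\frac{\mathrm{sgn}(p+s)}{\gcd(q,s-p,r)}(r,s-p,-q)$, a primitive indefinite form; the çark $\langle M\rangle\backslash\mathcal{F}$ directed by $M$ represents the class $[f_M]$. A form $(A,B,C)$ is reciprocal if $C=-A$. -}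

module Defs where

open import Algebra.Bundles using (Group)
open import Data.Integer.Base as ℤ
  using (ℤ; +_; 0ℤ; 1ℤ; -1ℤ; ∣_∣; _+_; _*_; -_; _-_; _/_; sign; _◃_)
open import Data.Integer.GCD using (gcd; gcd[i,j]≡0⇒i≡0; gcd[i,j]≡0⇒j≡0)
import Data.Integer.Properties as ℤₚ
open import Data.Integer.Tactic.RingSolver using (solve-∀)
open import Data.Nat.Base as ℕ using (ℕ)
import Data.Nat.Properties as ℕₚ
open import Data.Product.Base using (Σ; ∃-syntax; _×_; _,_)
open import Function.Bundles using (Func; Inverse; _⇔_)
open import Level using (0ℓ)
open import Relation.Binary.Bundles using (Setoid)
open import Relation.Binary.PropositionalEquality
  using (_≡_; refl; sym; trans; cong; cong₂; subst)

-- Without η, products of variable matrices stay folded and unify well.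
record SL₂ℤ : Set where
  no-eta-equality
  pattern
  constructor mat
  field
    p q r s : ℤ
    det     : p * s - q * r ≡ 1ℤ

infix 4 _≐_ _≈_

_≐_ : SL₂ℤ → SL₂ℤ → Set
A ≐ B = A.p ≡ B.p × A.q ≡ B.q × A.r ≡ B.r × A.s ≡ B.s
  where module A = SL₂ℤ A
        module B = SL₂ℤ B

neg : SL₂ℤ → SL₂ℤ
neg (mat p q r s det) = mat (- p) (- q) (- r) (- s) (trans (lem p q r s) det)
  where
  lem : ∀ p q r s → (- p) * (- s) - (- q) * (- r) ≡ p * s - q * r
  lem = solve-∀

-- PSL₂(ℤ) is SL₂ℤ with this equality.
data _≈_ (A B : SL₂ℤ) : Set where
  same : A ≐ B → A ≈ B
  opp  : A ≐ neg B → A ≈ B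

infixl 7 _∙_

_∙_ : SL₂ℤ → SL₂ℤ → SL₂ℤ
mat p q r s det ∙ mat p′ q′ r′ s′ det′ =
  mat (p * p′ + q * r′) (p * q′ + q * s′) (r * p′ + s * r′) (r * q′ + s * s′)
      (trans (lem p q r s p′ q′ r′ s′) (cong₂ _*_ det det′))
  where
  lem : ∀ p q r s p′ q′ r′ s′ →
        (p * p′ + q * r′) * (r * q′ + s * s′) - (p * q′ + q * s′) * (r * p′ + s * r′)
        ≡ (p * s - q * r) * (p′ * s′ - q′ * r′)
  lem = solve-∀

inv : SL₂ℤ → SL₂ℤ
inv (mat p q r s det) = mat s (- q) (- r) p (trans (lem p q r s) det)
  where
  lem : ∀ p q r s → s * p - (- q) * (- r) ≡ p * s - q * r
  lem = solve-∀

I S R : SL₂ℤ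
I = mat 1ℤ 0ℤ 0ℤ 1ℤ refl
S = mat 0ℤ -1ℤ 1ℤ 0ℤ refl
R = mat 1ℤ -1ℤ 1ℤ 0ℤ refl

≈-refl : ∀ {A} → A ≈ A
≈-refl = same (refl , refl , refl , refl)

≈-sym : ∀ {A B} → A ≈ B → B ≈ A
≈-sym {mat _ _ _ _ _} {mat _ _ _ _ _} (same (refl , refl , refl , refl)) = same (refl , refl , refl , refl)
≈-sym {mat _ _ _ _ _} {mat p q r s _} (opp (refl , refl , refl , refl)) =
  opp (flip p , flip q , flip r , flip s)
  where
  flip : ∀ i → i ≡ - (- i)
  flip i = sym (ℤₚ.neg-involutive i)

≈-trans : ∀ {A B C} → A ≈ B → B ≈ C → A ≈ C
≈-trans {mat _ _ _ _ _} {mat _ _ _ _ _} {mat _ _ _ _ _}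
  (same (refl , refl , refl , refl)) (same e) = same e
≈-trans {mat _ _ _ _ _} {mat _ _ _ _ _} {mat _ _ _ _ _}
  (same (refl , refl , refl , refl)) (opp e) = opp e
≈-trans {mat _ _ _ _ _} {mat _ _ _ _ _} {mat _ _ _ _ _}
  (opp e) (same (refl , refl , refl , refl)) = opp e
≈-trans {mat _ _ _ _ _} {mat _ _ _ _ _} {mat p q r s _}
  (opp (refl , refl , refl , refl)) (opp (refl , refl , refl , refl)) =
  same (ℤₚ.neg-involutive p , ℤₚ.neg-involutive q
      , ℤₚ.neg-involutive r , ℤₚ.neg-involutive s)

∙-cong : ∀ {A B C D} → A ≈ B → C ≈ D → A ∙ C ≈ B ∙ D
∙-cong {mat _ _ _ _ _} {mat _ _ _ _ _} {mat _ _ _ _ _} {mat _ _ _ _ _}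
  (same (refl , refl , refl , refl)) (same (refl , refl , refl , refl)) = same (refl , refl , refl , refl)
∙-cong {mat p q r s _} {mat _ _ _ _ _} {mat _ _ _ _ _} {mat p′ q′ r′ s′ _}
  (same (refl , refl , refl , refl)) (opp (refl , refl , refl , refl)) =
  opp (n p q p′ r′ , n p q q′ s′ , n r s p′ r′ , n r s q′ s′)
  where
  n : ∀ i j k m → i * (- k) + j * (- m) ≡ - (i * k + j * m)
  n = solve-∀
∙-cong {mat _ _ _ _ _} {mat p q r s _} {mat p′ q′ r′ s′ _} {mat _ _ _ _ _}
  (opp (refl , refl , refl , refl)) (same (refl , refl , refl , refl)) =
  opp (n p q p′ r′ , n p q q′ s′ , n r s p′ r′ , n r s q′ s′)
  where
  n : ∀ i j k m → (- i) * k + (- j) * m ≡ - (i * k + j * m)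
  n = solve-∀
∙-cong {mat _ _ _ _ _} {mat p q r s _} {mat _ _ _ _ _} {mat p′ q′ r′ s′ _}
  (opp (refl , refl , refl , refl)) (opp (refl , refl , refl , refl)) =
  same (n p q p′ r′ , n p q q′ s′ , n r s p′ r′ , n r s q′ s′)
  where
  n : ∀ i j k m → (- i) * (- k) + (- j) * (- m) ≡ i * k + j * m
  n = solve-∀

∙-assoc : ∀ A B C → (A ∙ B) ∙ C ≈ A ∙ (B ∙ C)
∙-assoc (mat a b c d _) (mat e f g h _) (mat i j k l _) =
  same (lem a b e f g h i k , lem a b e f g h j l
      , lem c d e f g h i k , lem c d e f g h j l)
  where
  lem : ∀ a b e f g h i k →
        (a * e + b * g) * i + (a * f + b * h) * k
        ≡ a * (e * i + f * k) + b * (g * i + h * k)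
  lem = solve-∀

identityˡ : ∀ A → I ∙ A ≈ A
identityˡ (mat p q r s _) = same (u p r , u q s , v p r , v q s)
  where
  u : ∀ i j → 1ℤ * i + 0ℤ * j ≡ i
  u = solve-∀
  v : ∀ i j → 0ℤ * i + 1ℤ * j ≡ j
  v = solve-∀

identityʳ : ∀ A → A ∙ I ≈ A
identityʳ (mat p q r s _) = same (u p q , v p q , u r s , v r s)
  where
  u : ∀ i j → i * 1ℤ + j * 0ℤ ≡ i
  u = solve-∀
  v : ∀ i j → i * 0ℤ + j * 1ℤ ≡ j
  v = solve-∀

inverseˡ : ∀ A → inv A ∙ A ≈ I
inverseˡ (mat p q r s det) =
  same (trans (w p q r s) det , x q s , y p r , trans (z p q r s) det)
  where
  w : ∀ p q r s → s * p + (- q) * r ≡ p * s - q * r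
  w = solve-∀
  x : ∀ q s → s * q + (- q) * s ≡ 0ℤ
  x = solve-∀
  y : ∀ p r → (- r) * p + p * r ≡ 0ℤ
  y = solve-∀
  z : ∀ p q r s → (- r) * q + p * s ≡ p * s - q * r
  z = solve-∀

inverseʳ : ∀ A → A ∙ inv A ≈ I
inverseʳ (mat p q r s det) =
  same (trans (w p q r s) det , x p q , y r s , trans (z p q r s) det)
  where
  w : ∀ p q r s → p * s + q * (- r) ≡ p * s - q * r
  w = solve-∀
  x : ∀ p q → p * (- q) + q * p ≡ 0ℤ
  x = solve-∀
  y : ∀ r s → r * s + s * (- r) ≡ 0ℤ
  y = solve-∀
  z : ∀ p q r s → r * (- q) + s * p ≡ p * s - q * r
  z = solve-∀

inv-cong : ∀ {A B} → A ≈ B → inv A ≈ inv B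
inv-cong {mat _ _ _ _ _} {mat _ _ _ _ _} (same (refl , refl , refl , refl)) = same (refl , refl , refl , refl)
inv-cong {mat _ _ _ _ _} {mat _ _ _ _ _} (opp (refl , refl , refl , refl)) =
  opp (refl , refl , refl , refl)

PSL₂ℤ : Group 0ℓ 0ℓ
PSL₂ℤ = record
  { Carrier = SL₂ℤ ; _≈_ = _≈_ ; _∙_ = _∙_ ; ε = I ; _⁻¹ = inv
  ; isGroup = record
    { isMonoid = record
      { isSemigroup = record
        { isMagma = record
          { isEquivalence = record { refl = ≈-refl ; sym = ≈-sym ; trans = ≈-trans }
          ; ∙-cong = ∙-cong }
        ; assoc = ∙-assoc }
      ; identity = identityˡ , identityʳ }
    ; inverse = inverseˡ , inverseʳ
    ; ⁻¹-cong = inv-cong } }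

module PSL = Group PSL₂ℤ

trace : SL₂ℤ → ℤ
trace (mat p q r s _) = p + s

Hyperbolic : SL₂ℤ → Set
Hyperbolic M = 2 ℕ.< ∣ trace M ∣

data ⟨_⟩ (M : SL₂ℤ) : SL₂ℤ → Set where
  gen  : ⟨ M ⟩ M
  unit : ⟨ M ⟩ I
  mul  : ∀ {A B} → ⟨ M ⟩ A → ⟨ M ⟩ B → ⟨ M ⟩ (A ∙ B)
  inve : ∀ {A} → ⟨ M ⟩ A → ⟨ M ⟩ (inv A)

-- Equality of edges of ⟨M⟩\𝓕: being in the same orbit of ⟨M⟩ acting on
-- the left.
data _∼[_]_ (W M W′ : SL₂ℤ) : Set where
  by : ∀ N → ⟨ M ⟩ N → N ∙ W ≈ W′ → W ∼[ M ] W′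

≈⇒∼ : ∀ {M W W′} → W ≈ W′ → W ∼[ M ] W′
≈⇒∼ e = by I unit (≈-trans (identityˡ _) e)

∼-sym : ∀ {M W W′} → W ∼[ M ] W′ → W′ ∼[ M ] W
∼-sym {M} {W} {W′} (by N n e) = by (inv N) (inve n) (begin
  inv N ∙ W′        ≈⟨ ∙-cong ≈-refl e ⟨
  inv N ∙ (N ∙ W)   ≈⟨ ∙-assoc (inv N) N W ⟨
  inv N ∙ N ∙ W     ≈⟨ ∙-cong (inverseˡ N) ≈-refl ⟩
  I ∙ W             ≈⟨ identityˡ W ⟩
  W                 ∎)
  where open import Relation.Binary.Reasoning.Setoid PSL.setoid

∼-trans : ∀ {M W W′ W″} → W ∼[ M ] W′ → W′ ∼[ M ] W″ → W ∼[ M ] W″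
∼-trans {M} {W} {W′} {W″} (by N n e) (by N′ n′ e′) = by (N′ ∙ N) (mul n′ n) (begin
  N′ ∙ N ∙ W     ≈⟨ ∙-assoc N′ N W ⟩
  N′ ∙ (N ∙ W)   ≈⟨ ∙-cong ≈-refl e ⟩
  N′ ∙ W′        ≈⟨ e′ ⟩
  W″             ∎)
  where open import Relation.Binary.Reasoning.Setoid PSL.setoid

∼-congʳ : ∀ {M W W′} X → W ∼[ M ] W′ → (W ∙ X) ∼[ M ] (W′ ∙ X)
∼-congʳ X (by N n e) = by N n (≈-trans (≈-sym (∙-assoc N _ X)) (∙-cong e ≈-refl))

-- An edge joins a ⊗-vertex to a •-vertex.  The ⊗-vertices are the orbits
-- of σ, the •-vertices the orbits of ρ, and ρ gives the cyclic order of
-- the edges around each •-vertex, taken clockwise (around a ⊗-vertex,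
-- of degree at most 2, there is nothing to record).
record RibbonGraph : Set₁ where
  field
    Edge : Setoid 0ℓ 0ℓ
    σ ρ  : Func Edge Edge
  open Setoid Edge public using ()
    renaming (Carrier to E; _≈_ to _≈ᴱ_; refl to ≈ᴱ-refl; sym to ≈ᴱ-sym; trans to ≈ᴱ-trans)
  open Func σ public using () renaming (to to σ⟨_⟩; cong to σ-cong)
  open Func ρ public using () renaming (to to ρ⟨_⟩; cong to ρ-cong)
  field
    σ² : ∀ e → σ⟨ σ⟨ e ⟩ ⟩ ≈ᴱ e
    ρ³ : ∀ e → ρ⟨ ρ⟨ ρ⟨ e ⟩ ⟩ ⟩ ≈ᴱ e

data Direction : Set where
  ⟶• ⟶⊗ : Direction

opposite : Direction → Direction
opposite ⟶• = ⟶⊗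
opposite ⟶⊗ = ⟶•

-- The inner side of a directed path is its left-hand side.
data Side : Set where
  inner outer : Side

swap : Side → Side
swap inner = outer
swap outer = inner

module _ (G : RibbonGraph) where
  open RibbonGraph G

  DirectedEdge : Set
  DirectedEdge = E × Direction

  -- A path entering a •-vertex by e and leaving by exit b e has the third
  -- edge of that vertex on its side b: ρ being clockwise, ρ e is the left
  -- turn, which leaves the third edge ρ² e on the right.
  exit : Side → E → E
  exit outer e = ρ⟨ e ⟩
  exit inner e = ρ⟨ ρ⟨ e ⟩ ⟩

  -- Consecutive edges of a path without backtracking.
  data Step : DirectedEdge → DirectedEdge → Set where
    through-⊗ : ∀ {e e′} → e′ ≈ᴱ σ⟨ e ⟩ → Step (e , ⟶⊗) (e′ , ⟶•)
    through-• : ∀ {e e′} b → e′ ≈ᴱ exit b e → Step (e , ⟶•) (e′ , ⟶⊗)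

-- The Farey tree.  Its ρ is clockwise because the derivative of R at its
-- fixed point e^{iπ/3} is e^{-2iπ/3}.

·S ·R : SL₂ℤ → SL₂ℤ
·S W = W ∙ S
·R W = W ∙ R

·S² : ∀ W → ·S (·S W) ≈ W
·S² W = begin
  W ∙ S ∙ S     ≈⟨ ∙-assoc W S S ⟩
  W ∙ (S ∙ S)   ≈⟨ ∙-cong ≈-refl (opp (refl , refl , refl , refl)) ⟩
  W ∙ I         ≈⟨ identityʳ W ⟩
  W             ∎
  where open import Relation.Binary.Reasoning.Setoid PSL.setoid

·R³ : ∀ W → ·R (·R (·R W)) ≈ W
·R³ W = begin
  W ∙ R ∙ R ∙ R       ≈⟨ ∙-assoc (W ∙ R) R R ⟩
  W ∙ R ∙ (R ∙ R)     ≈⟨ ∙-assoc W R (R ∙ R) ⟩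
  W ∙ (R ∙ (R ∙ R))   ≈⟨ ∙-cong ≈-refl (opp (refl , refl , refl , refl)) ⟩
  W ∙ I               ≈⟨ identityʳ W ⟩
  W                   ∎
  where open import Relation.Binary.Reasoning.Setoid PSL.setoid

𝓕 : RibbonGraph
𝓕 = record
  { Edge = PSL.setoid
  ; σ    = record { to = ·S ; cong = λ e → ∙-cong e ≈-refl }
  ; ρ    = record { to = ·R ; cong = λ e → ∙-cong e ≈-refl }
  ; σ²   = ·S²
  ; ρ³   = ·R³
  }

-- The axis of M in 𝓕, directed by the translation direction of M: a
-- bi-infinite path without backtracking along which M translates forward.
record Axis (M : SL₂ℤ) : Set where
  field
    edge   : ℤ → SL₂ℤ
    dir    : ℤ → Direction
    step   : ∀ k → Step 𝓕 (edge k , dir k) (edge (k + 1ℤ) , dir (k + 1ℤ))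
    period : ℕ
    period-nonZero : ℕ.NonZero period
    translates : ∀ k → M ∙ edge k ≈ edge (k + + period)
                     × dir k ≡ dir (k + + period)

OnAxis : SL₂ℤ → SL₂ℤ × Direction → Set
OnAxis M (W , δ) = Σ (Axis M) λ ℓ → ∃[ k ] Axis.edge ℓ k ≈ W × Axis.dir ℓ k ≡ δ

-- A ribbon graph with a directed subgraph; (e , δ) is in Spine when the
-- spine runs through e in the direction δ.  The ribbon structure and the
-- direction of the spine determine the two boundaries: inner is to the left.
record SpinedGraph : Set₁ where
  field
    graph : RibbonGraph
  open RibbonGraph graph public
  field
    Spine      : DirectedEdge graph → Set
    Spine-resp : ∀ {e e′ δ} → e ≈ᴱ e′ → Spine (e , δ) → Spine (e′ , δ)

_\\𝓕 : SL₂ℤ → RibbonGraph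
M \\𝓕 = record
  { Edge = record
    { Carrier = SL₂ℤ ; _≈_ = _∼[ M ]_
    ; isEquivalence = record
      { refl = ≈⇒∼ ≈-refl ; sym = ∼-sym ; trans = ∼-trans } }
  ; σ  = record { to = ·S ; cong = ∼-congʳ S }
  ; ρ  = record { to = ·R ; cong = ∼-congʳ R }
  ; σ² = λ W → ≈⇒∼ (·S² W)
  ; ρ³ = λ W → ≈⇒∼ (·R³ W)
  }

çark : SL₂ℤ → SpinedGraph
çark M = record
  { graph      = M \\𝓕
  ; Spine      = λ (W , δ) → ∃[ V ] OnAxis M (V , δ) × V ∼[ M ] W
  ; Spine-resp = λ e (V , a , v) → V , a , ∼-trans v e
  }

record _≅_ (C D : SpinedGraph) : Set where
  private
    module C = SpinedGraph C
    module D = SpinedGraph D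
  field
    bijection : Inverse C.Edge D.Edge
  open Inverse bijection public using (to)
  field
    preserves-σ : ∀ e → to C.σ⟨ e ⟩ D.≈ᴱ D.σ⟨ to e ⟩
    preserves-ρ : ∀ e → to C.ρ⟨ e ⟩ D.≈ᴱ D.ρ⟨ to e ⟩
    preserves-spine : ∀ e δ → C.Spine (e , δ) ⇔ D.Spine (to e , δ)

-- A reflection reverses the cyclic order at every vertex.
mirror : RibbonGraph → RibbonGraph
mirror G = record
  { Edge = Edge
  ; σ    = σ
  ; ρ    = record { to = λ e → ρ⟨ ρ⟨ e ⟩ ⟩ ; cong = λ e → ρ-cong (ρ-cong e) }
  ; σ²   = σ²
  ; ρ³   = λ e → ≈ᴱ-trans (ρ³ _) (ρ³ e)
  }
  where open RibbonGraph G

-- The reflection with respect to the spine fixes the directed spine, so it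
-- remains counterclockwise.
_ᵐ : SpinedGraph → SpinedGraph
C ᵐ = record
  { graph = mirror graph ; Spine = Spine ; Spine-resp = Spine-resp }
  where open SpinedGraph C

-- The reflection about a line through the centre turns the counterclockwise
-- spine into a clockwise one; it is directed counterclockwise again by
-- reversing it.
_ʳ : SpinedGraph → SpinedGraph
C ʳ = record
  { graph      = mirror graph
  ; Spine      = λ (e , δ) → Spine (e , opposite δ)
  ; Spine-resp = Spine-resp }
  where open SpinedGraph C

Reciprocal : SpinedGraph → Set
Reciprocal C = C ≅ ((C ᵐ) ʳ)

-- Reading the cyclic word: the spine enters a •-vertex by e, leaves it by
-- e′, and the branch there goes to the boundary b.  ᵐ-letter says that ᵐ
-- swaps inner and outer and keeps the order; ʳ-letter says that ʳ keeps
-- inner and outer and reverses the order.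
Letter : (C : SpinedGraph) → let open SpinedGraph C in E → Side → E → Set
Letter C e b e′ = Spine (e , ⟶•) × Spine (e′ , ⟶⊗) × e′ ≈ᴱ exit graph b e
  where open SpinedGraph C

ᵐ-letter : ∀ C {e b e′} → Letter C e b e′ → Letter (C ᵐ) e (swap b) e′
ᵐ-letter C {b = inner}     (x , y , z) = x , y , z
ᵐ-letter C {e} {outer} (x , y , z) = x , y , ≈ᴱ-trans z (≈ᴱ-sym (ρ³ ρ⟨ e ⟩))
  where open SpinedGraph C

ʳ-letter : ∀ C {e b e′} → Letter C e b e′ → Letter (C ʳ) e′ b e
ʳ-letter C {e} {inner} (x , y , z) = y , x ,
  ≈ᴱ-sym (≈ᴱ-trans (ρ-cong (ρ-cong (ρ-cong (ρ-cong z))))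
         (≈ᴱ-trans (ρ³ _) (ρ³ e)))
  where open SpinedGraph C
ʳ-letter C {e} {outer} (x , y , z) = y , x ,
  ≈ᴱ-sym (≈ᴱ-trans (ρ-cong (ρ-cong z)) (ρ³ e))
  where open SpinedGraph C

-- (A , B , C) is A x² + B x y + C y².
record Form : Set where
  constructor form
  field
    A B C : ℤ

eval : Form → ℤ → ℤ → ℤ
eval (form A B C) x y = A * x * x + B * x * y + C * y * y

infixr 7 _·_

_·_ : SL₂ℤ → Form → Form
mat p q r s _ · form A B C = form
  (A * p * p + B * p * r + C * r * r)
  (+ 2 * A * p * q + B * (p * s + q * r) + + 2 * C * r * s)
  (A * q * q + B * q * s + C * s * s)

eval-· : ∀ U f x y → let open SL₂ℤ U in
         eval (U · f) x y ≡ eval f (p * x + q * y) (r * x + s * y)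
eval-· (mat p q r s _) (form A B C) = lem A B C p q r s
  where
  lem : ∀ A B C p q r s x y →
    (A * p * p + B * p * r + C * r * r) * x * x
    + (+ 2 * A * p * q + B * (p * s + q * r) + + 2 * C * r * s) * x * y
    + (A * q * q + B * q * s + C * s * s) * y * y
    ≡ A * (p * x + q * y) * (p * x + q * y)
    + B * (p * x + q * y) * (r * x + s * y)
    + C * (r * x + s * y) * (r * x + s * y)
  lem = solve-∀

infix 4 _∈[_]

_∈[_] : Form → Form → Set
g ∈[ f ] = ∃[ U ] g ≡ U · f

ReciprocalForm : Form → Set
ReciprocalForm (form A B C) = C ≡ - A

content : SL₂ℤ → ℤ
content (mat p q r s _) = gcd (gcd q (s - p)) r

content-nonZero : ∀ M → Hyperbolic M → ℤ.NonZero (content M)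
content-nonZero M@(mat p q r s det) hyp = ℤ.≢-nonZero λ g≡0 →
  let
    q≡0 : q ≡ 0ℤ
    q≡0 = gcd[i,j]≡0⇒i≡0 q (s - p) (gcd[i,j]≡0⇒i≡0 (gcd q (s - p)) r g≡0)
    s≡p : s ≡ p
    s≡p = ℤₚ.i-j≡0⇒i≡j s p
            (gcd[i,j]≡0⇒j≡0 {q} (gcd[i,j]≡0⇒i≡0 (gcd q (s - p)) r g≡0))
    p²≡1 : p * p ≡ 1ℤ
    p²≡1 = trans (lem p r) (subst (λ i → p * i - 0ℤ * r ≡ 1ℤ) s≡p
                           (subst (λ i → p * s - i * r ≡ 1ℤ) q≡0 det))
    ∣p∣≡1 : ∣ p ∣ ≡ 1
    ∣p∣≡1 = ℕₚ.m*n≡1⇒m≡1 ∣ p ∣ ∣ p ∣ (trans (sym (ℤₚ.abs-* p p)) (cong ∣_∣ p²≡1))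
    tr≤2 : ∣ p + s ∣ ℕ.≤ 2
    tr≤2 = ℕₚ.≤-trans (ℤₚ.∣i+j∣≤∣i∣+∣j∣ p s)
             (ℕₚ.≤-reflexive (cong₂ ℕ._+_ ∣p∣≡1 (trans (cong ∣_∣ s≡p) ∣p∣≡1)))
  in ℕₚ.<⇒≱ hyp tr≤2
  where
  lem : ∀ p r → p * p ≡ p * p - 0ℤ * r
  lem = solve-∀

-- f_M; the division is exact.
formOf : (M : SL₂ℤ) → Hyperbolic M → Form
formOf M@(mat p q r s _) hyp = form (ε * (r / g)) (ε * ((s - p) / g)) (ε * ((- q) / g))
  where
  ε g : ℤ
  ε = sign (trace M) ◃ 1
  g = content M
  instance
    g≢0 : ℤ.NonZero g
    g≢0 = content-nonZero M hyp

{-# OPTIONS --safe #-}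
module Submission where

-- As ρ⁴ = ρ, an isomorphism from the çark of M to its image under ᵐ and ʳ is
-- an automorphism of ⟨M⟩\𝓕 that reverses the spine.  PSL₂(ℤ) being generated
-- by S and R, it is left multiplication by some U, and U M U⁻¹ is M or M⁻¹,
-- the only powers of M with its discriminant.  It is not M: U would preserve
-- the direction of the axis, while no edge lies on the axis in both
-- directions, as M read along a directed edge is a product of nonnegative
-- matrices up to sign.  From U M U⁻¹ = M⁻¹ it follows that U has trace 0, so
-- U = V S V⁻¹ for some V.  Finally S inverts Y = V⁻¹ M V if and only if Y is
-- symmetric, that is, if and only if V · f_M is reciprocal.

open import Defs
open import Data.Bool.Base using (Bool; true; false; not)
open import Data.Empty using (⊥; ⊥-elim)
open import Data.Integer.Base as ℤ
  using (ℤ; +_; -[1+_]; +[1+_]; 0ℤ; 1ℤ; -1ℤ; ∣_∣; _+_; _*_; -_; _-_; _/_; _%_; sign; _◃_)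
open import Data.Integer.Divisibility using (_∣_)
import Data.Integer.Divisibility.Signed as Signed
import Data.Integer.DivMod as ℤ
open import Data.Integer.GCD using (gcd; gcd[i,j]∣i; gcd[i,j]∣j)
import Data.Integer.Properties as ℤₚ
open import Data.Integer.Tactic.RingSolver using (solve-∀)
open import Data.List.Base using (List; []; _∷_; _∷ʳ_; _++_; length; initLast; _∷ʳ′_)
import Data.List.Properties as Listₚ
open import Data.Maybe.Base using (Maybe; just; nothing)
open import Data.Nat.Base as ℕ using (ℕ; zero; suc)
import Data.Nat.Divisibility as ℕ using (_∣_; ∣-trans)
import Data.Nat.Properties as ℕₚ
open import Data.Product.Base using (∃-syntax; _×_; _,_; proj₁; proj₂)
open import Data.Sum.Base using (_⊎_; inj₁; inj₂)
open import Function.Bundles using (_⇔_; mk⇔; Equivalence; Inverse)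
open import Relation.Nullary using (¬_)
open import Relation.Binary.PropositionalEquality
  using (_≡_; _≢_; refl; sym; trans; cong; cong₂; subst; module ≡-Reasoning)
open import Algebra.Properties.Group PSL₂ℤ using (∙-cancelˡ; ∙-cancelʳ)
import Relation.Binary.Reasoning.Setoid as SetoidReasoning

-- The spine is defined through the axes of `M`, and preserving it says nothing if there are none:
-- the argument on directions has force only because an axis exists, and most of the work goes into
-- constructing one. Since PSL₂(ℤ) is the free product of the groups of order 2 and 3 generated by
-- `S` and `R`, every element should be conjugate to `I`, `S`, `R`, `R ∙ R` or a nonempty word in
-- `R ∙ S` and `R ∙ R ∙ S`. For hyperbolic `M` the trace leaves only the word, and walking along it
-- periodically traces out an axis. The same reduction provides the `V` for an element of trace 0,
-- because a word, being nonnegative up to sign, has nonzero trace.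
--
-- A second obstacle is the sign: an equality in PSL₂(ℤ) is one of two matrix equalities, and the
-- case `opp` usually calls for an argument of its own, on traces or determinants.

private
  module ≈-Reasoning = SetoidReasoning PSL.setoid

∙-congˡ : ∀ {A B} C → A ≈ B → C ∙ A ≈ C ∙ B
∙-congˡ C e = ∙-cong (≈-refl {C}) e

∙-congʳ : ∀ {A B} C → A ≈ B → A ∙ C ≈ B ∙ C
∙-congʳ C e = ∙-cong e (≈-refl {C})

-- Generation by S and R

-- Closure under products already yields the group generated, as `S` and `R` have finite order in
-- PSL₂(ℤ).
data Generated : SL₂ℤ → Set where
  gen-S : Generated S
  gen-R : Generated R
  gen-∙ : ∀ {A B} → Generated A → Generated B → Generated (A ∙ B)
  resp  : ∀ {A B} → A ≈ B → Generated A → Generated B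

translation : ℤ → SL₂ℤ
translation n = mat 1ℤ n 0ℤ 1ℤ (lem n)
  where
  lem : ∀ n → 1ℤ * 1ℤ - n * 0ℤ ≡ 1ℤ
  lem = solve-∀

-- Up to sign `R ∙ S` is the translation by 1 and `S ∙ (R ∙ R)` is its inverse.
translation-generated : ∀ n → Generated (translation n)
translation-generated (+ zero) = resp (opp (refl , refl , refl , refl)) (gen-∙ gen-S gen-S)
translation-generated +[1+ n ] =
  resp (opp (lem₁ (+ n) , lem₂ (+ n) , refl , refl))
       (gen-∙ (translation-generated (+ n)) (gen-∙ gen-R gen-S))
  where
  lem₁ : ∀ n → 1ℤ * -1ℤ + n * 0ℤ ≡ -1ℤ
  lem₁ = solve-∀
  lem₂ : ∀ n → 1ℤ * -1ℤ + n * -1ℤ ≡ - (1ℤ + n)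
  lem₂ = solve-∀
translation-generated -[1+ zero ] =
  resp (opp (refl , refl , refl , refl)) (gen-∙ gen-S (gen-∙ gen-R gen-R))
translation-generated -[1+ suc n ] =
  resp (opp (lem₁ -[1+ n ] , lem₂ -[1+ n ] , refl , refl))
       (gen-∙ (translation-generated -[1+ n ]) (gen-∙ gen-S (gen-∙ gen-R gen-R)))
  where
  lem₁ : ∀ n → 1ℤ * -1ℤ + n * 0ℤ ≡ -1ℤ
  lem₁ = solve-∀
  lem₂ : ∀ n → 1ℤ * 1ℤ + n * -1ℤ ≡ - (-1ℤ + n)
  lem₂ = solve-∀

i*i≡j*j⇒i≡±j : ∀ i j → i * i ≡ j * j → i ≡ j ⊎ i ≡ - j
i*i≡j*j⇒i≡±j i j e with ℤₚ.i*j≡0⇒i≡0∨j≡0 (i - j) (trans (lem i j) (ℤₚ.i≡j⇒i-j≡0 e))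
  where
  lem : ∀ i j → (i - j) * (i + j) ≡ i * i - j * j
  lem = solve-∀
... | inj₁ z = inj₁ (ℤₚ.i-j≡0⇒i≡j i j z)
... | inj₂ z = inj₂ (ℤₚ.i-j≡0⇒i≡j i (- j) (trans (lem i j) z))
  where
  lem : ∀ i j → i - - j ≡ i + j
  lem = solve-∀

i*j≡1⇒i≡j≡±1 : ∀ i j → i * j ≡ 1ℤ → (i ≡ 1ℤ × j ≡ 1ℤ) ⊎ (i ≡ -1ℤ × j ≡ -1ℤ)
i*j≡1⇒i≡j≡±1 i j e
  with ℕₚ.m*n≡1⇒m≡1 ∣ i ∣ ∣ j ∣ (trans (sym (ℤₚ.abs-* i j)) (cong ∣_∣ e))
i*j≡1⇒i≡j≡±1 (+ 1)    j e | refl = inj₁ (refl , trans (sym (ℤₚ.*-identityˡ j)) e)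
i*j≡1⇒i≡j≡±1 -[1+ 0 ] j e | refl =
  inj₂ (refl , trans (sym (ℤₚ.neg-involutive j)) (cong -_ (trans (sym (ℤₚ.-1*i≡-i j)) e)))

-- The Euclidean algorithm on the first column.
generated : ∀ W → Generated W
generated W = go _ W ℕₚ.≤-refl
  where
  upper : ∀ p q s det → Generated (mat p q 0ℤ s det)
  upper p q s det with i*j≡1⇒i≡j≡±1 p s (trans (lem p q s) det)
    where
    lem : ∀ p q s → p * s ≡ p * s - q * 0ℤ
    lem = solve-∀
  ... | inj₁ (refl , refl) = resp (same (refl , refl , refl , refl)) (translation-generated q)
  ... | inj₂ (refl , refl) =
    resp (opp (refl , refl , refl , refl)) (translation-generated (- q))

  go : ∀ n W → ∣ SL₂ℤ.r W ∣ ℕ.≤ n → Generated W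
  step : ∀ n p q r s det .{{_ : ℤ.NonZero r}} → ∣ r ∣ ℕ.≤ suc n → Generated (mat p q r s det)

  go n (mat p q (+ zero) s det) le = upper p q s det
  go (suc n) (mat p q r@(+[1+ _ ]) s det) le = step n p q r s det le
  go (suc n) (mat p q r@(-[1+ _ ]) s det) le = step n p q r s det le

  step n p q r s det le =
    resp (same (lem₁ p r k , lem₁ q s k , lem₂ p r k , lem₂ q s k))
         (gen-∙ (translation-generated k) (gen-∙ gen-S (go n W′ le′)))
    where
    -- `W` is `translation k ∙ S ∙ W′`, and the lower left entry of `W′` is minus the remainder of
    -- `p` modulo `r`, hence smaller than `r` in absolute value.
    k = p / r
    W′ = mat r s (k * r - p) (k * s - q) (trans (lem p q r s k) det)
      where
      lem : ∀ p q r s k → r * (k * s - q) - s * (k * r - p) ≡ p * s - q * r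
      lem = solve-∀
    lem₁ : ∀ p r k → 1ℤ * (0ℤ * r + -1ℤ * (k * r - p)) + k * (1ℤ * r + 0ℤ * (k * r - p)) ≡ p
    lem₁ = solve-∀
    lem₂ : ∀ p r k → 0ℤ * (0ℤ * r + -1ℤ * (k * r - p)) + 1ℤ * (1ℤ * r + 0ℤ * (k * r - p)) ≡ r
    lem₂ = solve-∀
    remainder : k * r - p ≡ - (+ (p % r))
    remainder = trans (cong (λ i → k * r - i) (ℤ.a≡a%n+[a/n]*n p r)) (lem (k * r) (+ (p % r)))
      where
      lem : ∀ i j → i - (j + i) ≡ - j
      lem = solve-∀
    le′ : ∣ k * r - p ∣ ℕ.≤ n
    le′ = ℕ.s≤s⁻¹ (ℕₚ.≤-trans (ℕₚ.≤-trans (ℕₚ.≤-reflexive (cong suc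
            (trans (cong ∣_∣ remainder) (ℤₚ.∣-i∣≡∣i∣ (+ (p % r))))))
            (ℤ.n%d<d p r)) le)

-- Intertwining and conjugation

infix 4 _↝[_]_
-- `Y` is V⁻¹ X V, stated free of inverses so that products, inverses and changes of `V` only need
-- reassociation. For `X` = `Y` it says that `X` and `V` commute.
_↝[_]_ : SL₂ℤ → SL₂ℤ → SL₂ℤ → Set
X ↝[ V ] Y = X ∙ V ≈ V ∙ Y

inter-∙ : ∀ {X X′ Y Y′ V} → X ↝[ V ] X′ → Y ↝[ V ] Y′ → (X ∙ Y) ↝[ V ] (X′ ∙ Y′)
inter-∙ {X} {X′} {Y} {Y′} {V} x y = begin
  X ∙ Y ∙ V      ≈⟨ ∙-assoc X Y V ⟩
  X ∙ (Y ∙ V)    ≈⟨ ∙-congˡ X y ⟩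
  X ∙ (V ∙ Y′)   ≈⟨ ∙-assoc X V Y′ ⟨
  X ∙ V ∙ Y′     ≈⟨ ∙-congʳ Y′ x ⟩
  V ∙ X′ ∙ Y′    ≈⟨ ∙-assoc V X′ Y′ ⟩
  V ∙ (X′ ∙ Y′)  ∎
  where open ≈-Reasoning

inter-I : ∀ V → I ↝[ V ] I
inter-I V = ≈-trans (identityˡ V) (≈-sym (identityʳ V))

inter-trans : ∀ {X Y Z V W} → X ↝[ V ] Y → Y ↝[ W ] Z → X ↝[ V ∙ W ] Z
inter-trans {X} {Y} {Z} {V} {W} x y = begin
  X ∙ (V ∙ W)  ≈⟨ ∙-assoc X V W ⟨
  X ∙ V ∙ W    ≈⟨ ∙-congʳ W x ⟩
  V ∙ Y ∙ W    ≈⟨ ∙-assoc V Y W ⟩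
  V ∙ (Y ∙ W)  ≈⟨ ∙-congˡ V y ⟩
  V ∙ (W ∙ Z)  ≈⟨ ∙-assoc V W Z ⟨
  V ∙ W ∙ Z    ∎
  where open ≈-Reasoning

inter-inv : ∀ {X Y V} → X ↝[ V ] Y → inv X ↝[ V ] inv Y
inter-inv {X} {Y} {V} x = ∙-cancelˡ X _ _ (begin
  X ∙ (inv X ∙ V)  ≈⟨ ∙-assoc X (inv X) V ⟨
  X ∙ inv X ∙ V    ≈⟨ ∙-congʳ V (inverseʳ X) ⟩
  I ∙ V            ≈⟨ inter-I V ⟩
  V ∙ I            ≈⟨ ∙-congˡ V (inverseʳ Y) ⟨
  V ∙ (Y ∙ inv Y)  ≈⟨ ∙-assoc V Y (inv Y) ⟨
  V ∙ Y ∙ inv Y    ≈⟨ ∙-congʳ (inv Y) x ⟨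
  X ∙ V ∙ inv Y    ≈⟨ ∙-assoc X V (inv Y) ⟩
  X ∙ (V ∙ inv Y)  ∎)
  where open ≈-Reasoning

inter-reflects-≈ : ∀ {X X′ Y Y′ V} → X ↝[ V ] X′ → Y ↝[ V ] Y′ → X ≈ Y → X′ ≈ Y′
inter-reflects-≈ {V = V} x y e =
  ∙-cancelˡ V _ _ (≈-trans (≈-sym x) (≈-trans (∙-congʳ V e) y))

inter-preserves-≈ : ∀ {X X′ Y Y′ V} → X ↝[ V ] X′ → Y ↝[ V ] Y′ → X′ ≈ Y′ → X ≈ Y
inter-preserves-≈ {V = V} x y e =
  ∙-cancelʳ V _ _ (≈-trans x (≈-trans (∙-congˡ V e) (≈-sym y)))

inter-conjugate : ∀ V X → (V ∙ X ∙ inv V) ↝[ V ] X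
inter-conjugate V X = begin
  V ∙ X ∙ inv V ∙ V    ≈⟨ ∙-assoc (V ∙ X) (inv V) V ⟩
  V ∙ X ∙ (inv V ∙ V)  ≈⟨ ∙-congˡ (V ∙ X) (inverseˡ V) ⟩
  V ∙ X ∙ I            ≈⟨ identityʳ (V ∙ X) ⟩
  V ∙ X                ∎
  where open ≈-Reasoning

inter-conjugate⁻¹ : ∀ V X → X ↝[ V ] (inv V ∙ X ∙ V)
inter-conjugate⁻¹ V X = begin
  X ∙ V                  ≈⟨ identityˡ (X ∙ V) ⟨
  I ∙ (X ∙ V)            ≈⟨ ∙-congʳ (X ∙ V) (inverseʳ V) ⟨
  V ∙ inv V ∙ (X ∙ V)    ≈⟨ ∙-assoc V (inv V) (X ∙ V) ⟩
  V ∙ (inv V ∙ (X ∙ V))  ≈⟨ ∙-congˡ V (∙-assoc (inv V) X V) ⟨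
  V ∙ (inv V ∙ X ∙ V)    ∎
  where open ≈-Reasoning

Inverts : SL₂ℤ → SL₂ℤ → Set
Inverts X Y = X ∙ Y ≈ inv Y ∙ X

Conjugate : SL₂ℤ → SL₂ℤ → Set
Conjugate X Y = ∃[ V ] X ↝[ V ] Y

≈⇒conjugate : ∀ {X Y} → X ≈ Y → Conjugate X Y
≈⇒conjugate {X} {Y} e = I , ≈-trans (identityʳ X) (≈-trans e (≈-sym (identityˡ Y)))

conjugate-trans : ∀ {X Y Z} → Conjugate X Y → Conjugate Y Z → Conjugate X Z
conjugate-trans (V , x) (W , y) = V ∙ W , inter-trans x y

∙-comm-conjugate : ∀ A B → Conjugate (A ∙ B) (B ∙ A)
∙-comm-conjugate A B = A , ∙-assoc A B A

-- Words in the two turns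

rotation : Side → SL₂ℤ
rotation outer = R
rotation inner = R ∙ R

exit-rotation : ∀ b W → exit 𝓕 b W ≈ W ∙ rotation b
exit-rotation outer W = ≈-refl
exit-rotation inner W = ∙-assoc W R R

rotation-swap : ∀ b → rotation b ∙ rotation (swap b) ≈ I
rotation-swap outer = opp (refl , refl , refl , refl)
rotation-swap inner = opp (refl , refl , refl , refl)

rotation² : ∀ b → rotation b ∙ rotation b ≈ rotation (swap b)
rotation² outer = ≈-refl
rotation² inner = opp (refl , refl , refl , refl)

-- Right multiplication by `letter b` leads from an edge heading for a •-vertex to the next such
-- edge, the third edge being left on side `b`. Up to sign the letters are the elementary matrices
-- (1 1; 0 1) for `outer` and (1 0; 1 1) for `inner`.
letter : Side → SL₂ℤ
letter b = rotation b ∙ S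

word : List Side → SL₂ℤ
word []      = I
word (b ∷ w) = letter b ∙ word w

word-++ : ∀ u v → word (u ++ v) ≈ word u ∙ word v
word-++ []      v = ≈-sym (identityˡ (word v))
word-++ (b ∷ u) v = ≈-trans (∙-congˡ (letter b) (word-++ u v)) (≈-sym (∙-assoc (letter b) (word u) (word v)))

word-∷ʳ : ∀ w b → word (w ∷ʳ b) ≈ word w ∙ letter b
word-∷ʳ w b = ≈-trans (word-++ w (b ∷ [])) (∙-congˡ (word w) (identityʳ (letter b)))

SS≈I : S ∙ S ≈ I
SS≈I = opp (refl , refl , refl , refl)

word-∷ʳ-S : ∀ w b → word (w ∷ʳ b) ∙ S ≈ word w ∙ rotation b
word-∷ʳ-S w b = begin
  word (w ∷ʳ b) ∙ S             ≈⟨ ∙-congʳ S (word-∷ʳ w b) ⟩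
  word w ∙ (rotation b ∙ S) ∙ S ≈⟨ ∙-congʳ S (∙-assoc (word w) (rotation b) S) ⟨
  word w ∙ rotation b ∙ S ∙ S   ≈⟨ ·S² (word w ∙ rotation b) ⟩
  word w ∙ rotation b           ∎
  where open ≈-Reasoning

length-∷ʳ : ∀ {A : Set} (w : List A) b → length (w ∷ʳ b) ≡ suc (length w)
length-∷ʳ w b = trans (Listₚ.length-++ w) (ℕₚ.+-comm (length w) 1)

-- Normal forms in the free product, and their reduction up to conjugacy

prefix : Bool → SL₂ℤ
prefix false = I
prefix true  = S

suffix : Maybe Side → SL₂ℤ
suffix nothing  = I
suffix (just b) = rotation b

NormalForm : SL₂ℤ → Set
NormalForm W = ∃[ a ] ∃[ w ] ∃[ c ] W ≈ prefix a ∙ word w ∙ suffix c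

normalForm-S : ∀ {W} → NormalForm W → NormalForm (W ∙ S)
normalForm-S {W} (a , w , just b , e) = a , w ∷ʳ b , nothing , (begin
  W ∙ S                               ≈⟨ ∙-congʳ S e ⟩
  prefix a ∙ word w ∙ rotation b ∙ S   ≈⟨ ∙-assoc (prefix a ∙ word w) (rotation b) S ⟩
  prefix a ∙ word w ∙ letter b         ≈⟨ ∙-assoc (prefix a) (word w) (letter b) ⟩
  prefix a ∙ (word w ∙ letter b)       ≈⟨ ∙-congˡ (prefix a) (word-∷ʳ w b) ⟨
  prefix a ∙ word (w ∷ʳ b)             ≈⟨ identityʳ (prefix a ∙ word (w ∷ʳ b)) ⟨
  prefix a ∙ word (w ∷ʳ b) ∙ I         ∎)
  where open ≈-Reasoning
normalForm-S {W} (a , w , nothing , e) with initLast w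
-- With no letter left, the new `S` meets the prefix; otherwise it cancels the `S` of the last
-- letter, whose rotation becomes the suffix.
... | [] = not a , [] , nothing , (begin
  W ∙ S                     ≈⟨ ∙-congʳ S e ⟩
  prefix a ∙ I ∙ I ∙ S       ≈⟨ toggle a ⟩
  prefix (not a) ∙ I ∙ I     ∎)
  where
  open ≈-Reasoning
  toggle : ∀ a → prefix a ∙ I ∙ I ∙ S ≈ prefix (not a) ∙ I ∙ I
  toggle false = same (refl , refl , refl , refl)
  toggle true  = opp (refl , refl , refl , refl)
... | w′ ∷ʳ′ b = a , w′ , just b , (begin
  W ∙ S                               ≈⟨ ∙-congʳ S e ⟩
  prefix a ∙ word (w′ ∷ʳ b) ∙ I ∙ S    ≈⟨ ∙-congʳ S (identityʳ (prefix a ∙ word (w′ ∷ʳ b))) ⟩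
  prefix a ∙ word (w′ ∷ʳ b) ∙ S        ≈⟨ ∙-assoc (prefix a) (word (w′ ∷ʳ b)) S ⟩
  prefix a ∙ (word (w′ ∷ʳ b) ∙ S)      ≈⟨ ∙-congˡ (prefix a) (word-∷ʳ-S w′ b) ⟩
  prefix a ∙ (word w′ ∙ rotation b)    ≈⟨ ∙-assoc (prefix a) (word w′) (rotation b) ⟨
  prefix a ∙ word w′ ∙ rotation b      ∎)
  where open ≈-Reasoning

normalForm-R : ∀ {W} → NormalForm W → NormalForm (W ∙ R)
normalForm-R {W} (a , w , c , e) = a , w , next c , (begin
  W ∙ R                           ≈⟨ ∙-congʳ R e ⟩
  prefix a ∙ word w ∙ suffix c ∙ R    ≈⟨ ∙-assoc (prefix a ∙ word w) (suffix c) R ⟩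
  prefix a ∙ word w ∙ (suffix c ∙ R)  ≈⟨ ∙-congˡ (prefix a ∙ word w) (suffix-R c) ⟩
  prefix a ∙ word w ∙ suffix (next c) ∎)
  where
  open ≈-Reasoning
  next : Maybe Side → Maybe Side
  next nothing      = just outer
  next (just outer) = just inner
  next (just inner) = nothing
  suffix-R : ∀ c → suffix c ∙ R ≈ suffix (next c)
  suffix-R nothing      = identityˡ R
  suffix-R (just outer) = ≈-refl
  suffix-R (just inner) = rotation-swap inner

normalForm-resp : ∀ {W W′} → W ≈ W′ → NormalForm W → NormalForm W′
normalForm-resp e (a , w , c , f) = a , w , c , ≈-trans (≈-sym e) f

normalForm : ∀ W → NormalForm W
normalForm W = normalForm-resp (identityˡ W)
  (act (generated W) (false , [] , nothing , same (refl , refl , refl , refl)))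
  where
  act : ∀ {V X} → Generated X → NormalForm V → NormalForm (V ∙ X)
  act gen-S nf = normalForm-S nf
  act gen-R nf = normalForm-R nf
  act {V} (gen-∙ {A} {B} a b) nf = normalForm-resp (∙-assoc V A B) (act b (act a nf))
  act {V} (resp e a) nf = normalForm-resp (∙-congˡ V e) (act a nf)

-- The representatives are told apart by traces: `I`, `S` and the rotations have trace 2, 0 and ±1,
-- while words have nonzero trace. So a hyperbolic element can only reduce to a word, and an element
-- of trace 0 only to `S`.
data CyclicallyReduced : SL₂ℤ → Set where
  isI      : CyclicallyReduced I
  isS      : CyclicallyReduced S
  rotates  : ∀ b → CyclicallyReduced (rotation b)
  isWord   : ∀ b w → CyclicallyReduced (word (b ∷ w))

Reducible : SL₂ℤ → Set
Reducible X = ∃[ Y ] Conjugate X Y × CyclicallyReduced Y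

reducible-conjugate : ∀ {X Y} → Conjugate X Y → Reducible Y → Reducible X
reducible-conjugate x (Z , y , z) = Z , conjugate-trans x y , z

reducible-resp : ∀ {X Y} → X ≈ Y → Reducible Y → Reducible X
reducible-resp e = reducible-conjugate (≈⇒conjugate e)

reduced⇒reducible : ∀ {X} → CyclicallyReduced X → Reducible X
reduced⇒reducible c = _ , ≈⇒conjugate ≈-refl , c

-- Conjugation brings the suffix in front of the first letter. Equal rotations merge into the other
-- one, and a word remains. Opposite rotations cancel; the exposed `S` goes to the end, strips the
-- last letter to a rotation, and leaves a shorter instance of the same problem. The bound `n` on
-- the length drives the mutual recursion.
word-suffix-reducible : ∀ n w c → length w ℕ.≤ n → Reducible (word w ∙ suffix c)
word-S-reducible   : ∀ n w → length w ℕ.≤ n → Reducible (word w ∙ S)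

word-suffix-reducible n [] nothing le = reducible-resp (identityˡ I) (reduced⇒reducible isI)
word-suffix-reducible n [] (just b) le = reducible-resp (identityˡ (rotation b)) (reduced⇒reducible (rotates b))
word-suffix-reducible n (b ∷ w) nothing le = reducible-resp (identityʳ (word (b ∷ w))) (reduced⇒reducible (isWord b w))
word-suffix-reducible (suc n) (b ∷ w) (just c) le =
  reducible-conjugate (∙-comm-conjugate (word (b ∷ w)) (rotation c))
    (reducible-resp assoc (meet b c))
  where
  open ≈-Reasoning
  assoc : rotation c ∙ (rotation b ∙ S ∙ word w) ≈ rotation c ∙ rotation b ∙ (S ∙ word w)
  assoc = begin
    rotation c ∙ (rotation b ∙ S ∙ word w)    ≈⟨ ∙-congˡ (rotation c) (∙-assoc (rotation b) S (word w)) ⟩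
    rotation c ∙ (rotation b ∙ (S ∙ word w))  ≈⟨ ∙-assoc (rotation c) (rotation b) (S ∙ word w) ⟨
    rotation c ∙ rotation b ∙ (S ∙ word w)    ∎
  cancelled : ∀ b c → rotation c ∙ rotation b ≈ I → Reducible (rotation c ∙ rotation b ∙ (S ∙ word w))
  cancelled b c e = reducible-resp (≈-trans (∙-congʳ (S ∙ word w) e) (identityˡ (S ∙ word w)))
    (reducible-conjugate (∙-comm-conjugate S (word w)) (word-S-reducible n w (ℕ.s≤s⁻¹ le)))
  merged : ∀ b → Reducible (rotation b ∙ rotation b ∙ (S ∙ word w))
  merged b = reducible-resp
    (≈-trans (∙-congʳ (S ∙ word w) (rotation² b)) (≈-sym (∙-assoc (rotation (swap b)) S (word w))))
    (reduced⇒reducible (isWord (swap b) w))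
  meet : ∀ b c → Reducible (rotation c ∙ rotation b ∙ (S ∙ word w))
  meet inner inner = merged inner
  meet outer outer = merged outer
  meet inner outer = cancelled inner outer (rotation-swap outer)
  meet outer inner = cancelled outer inner (rotation-swap inner)

word-S-reducible n w le with initLast w
word-S-reducible n .[] le | [] = reducible-resp (identityˡ S) (reduced⇒reducible isS)
word-S-reducible zero .(w ∷ʳ b) le | w ∷ʳ′ b
  with () ← subst (ℕ._≤ 0) (length-∷ʳ w b) le
word-S-reducible (suc n) .(w ∷ʳ b) le | w ∷ʳ′ b =
  reducible-resp (word-∷ʳ-S w b)
    (word-suffix-reducible n w (just b) (ℕ.s≤s⁻¹ (subst (ℕ._≤ suc n) (length-∷ʳ w b) le)))

reducible : ∀ X → Reducible X
reducible X with normalForm X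
... | false , w , c , e =
  reducible-resp (≈-trans e (∙-congʳ (suffix c) (identityˡ (word w)))) (word-suffix-reducible _ w c ℕₚ.≤-refl)
... | true , w , c , e =
  reducible-resp (≈-trans e (∙-assoc S (word w) (suffix c)))
    (reducible-conjugate (∙-comm-conjugate S (word w ∙ suffix c))
      (reducible-resp (∙-assoc (word w) (suffix c) S) (closed c)))
  where
  closed : ∀ c → Reducible (word w ∙ (suffix c ∙ S))
  closed nothing  = reducible-resp (∙-congˡ (word w) (identityˡ S)) (word-S-reducible _ w ℕₚ.≤-refl)
  closed (just b) = reducible-resp (≈-sym (word-∷ʳ w b))
    (reducible-resp (≈-sym (identityʳ (word (w ∷ʳ b)))) (word-suffix-reducible _ (w ∷ʳ b) nothing ℕₚ.≤-refl))

-- Traces and signs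

trace-∙-comm : ∀ A B → trace (A ∙ B) ≡ trace (B ∙ A)
trace-∙-comm (mat a b c d _) (mat p q r s _) = lem a b c d p q r s
  where
  lem : ∀ a b c d p q r s → a * p + b * r + (c * q + d * s) ≡ p * a + q * c + (r * b + s * d)
  lem = solve-∀

∣trace∣-cong : ∀ {A B} → A ≈ B → ∣ trace A ∣ ≡ ∣ trace B ∣
∣trace∣-cong {mat _ _ _ _ _} {mat _ _ _ _ _} (same (refl , refl , refl , refl)) = refl
∣trace∣-cong {mat _ _ _ _ _} {mat p q r s _} (opp (refl , refl , refl , refl)) =
  trans (cong ∣_∣ (sym (ℤₚ.neg-distrib-+ p s))) (ℤₚ.∣-i∣≡∣i∣ (p + s))

∣trace∣-inter : ∀ {X Y V} → X ↝[ V ] Y → ∣ trace X ∣ ≡ ∣ trace Y ∣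
∣trace∣-inter {X} {Y} {V} x = begin
  ∣ trace X ∣                      ≡⟨ ∣trace∣-cong X≈ ⟩
  ∣ trace (V ∙ (Y ∙ inv V)) ∣      ≡⟨ cong ∣_∣ (trace-∙-comm V (Y ∙ inv V)) ⟩
  ∣ trace (Y ∙ inv V ∙ V) ∣        ≡⟨ ∣trace∣-cong ≈Y ⟩
  ∣ trace Y ∣                      ∎
  where
  open ≡-Reasoning
  X≈ : X ≈ V ∙ (Y ∙ inv V)
  X≈ = ∙-cancelʳ V _ _ (≈-trans x (≈-trans (≈-sym (inter-conjugate V Y)) (∙-congʳ V (∙-assoc V Y (inv V)))))
  ≈Y : Y ∙ inv V ∙ V ≈ Y
  ≈Y = ≈-trans (∙-assoc Y (inv V) V) (≈-trans (∙-congˡ Y (inverseˡ V)) (identityʳ Y))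

NonNegative : SL₂ℤ → Set
NonNegative W = 0ℤ ℤ.≤ p × 0ℤ ℤ.≤ q × 0ℤ ℤ.≤ r × 0ℤ ℤ.≤ s
  where open SL₂ℤ W

NonNegativeUpToSign : SL₂ℤ → Set
NonNegativeUpToSign X = ∃[ Z ] X ≈ Z × NonNegative Z

nonNegative-∙ : ∀ {A B} → NonNegative A → NonNegative B → NonNegative (A ∙ B)
nonNegative-∙ {mat _ _ _ _ _} {mat _ _ _ _ _} (a , b , c , d) (p , q , r , s) =
  dot a p b r , dot a q b s , dot c p d r , dot c q d s
  where
  0≤* : ∀ {i j} → 0ℤ ℤ.≤ i → 0ℤ ℤ.≤ j → 0ℤ ℤ.≤ i * j
  0≤* {+ m} {+ n} _ _ = subst (0ℤ ℤ.≤_) (ℤₚ.pos-* m n) (ℤ.+≤+ ℕ.z≤n)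
  dot : ∀ {i j k l} → 0ℤ ℤ.≤ i → 0ℤ ℤ.≤ j → 0ℤ ℤ.≤ k → 0ℤ ℤ.≤ l → 0ℤ ℤ.≤ i * j + k * l
  dot i j k l = ℤₚ.+-mono-≤ (0≤* i j) (0≤* k l)

0≤n : ∀ {n} → 0ℤ ℤ.≤ + n
0≤n = ℤ.+≤+ ℕ.z≤n

letter-nonNegative : ∀ b → NonNegativeUpToSign (letter b)
letter-nonNegative outer =
  mat 1ℤ 1ℤ 0ℤ 1ℤ refl , opp (refl , refl , refl , refl) , (0≤n , 0≤n , 0≤n , 0≤n)
letter-nonNegative inner =
  mat 1ℤ 0ℤ 1ℤ 1ℤ refl , opp (refl , refl , refl , refl) , (0≤n , 0≤n , 0≤n , 0≤n)

word-nonNegative : ∀ w → NonNegativeUpToSign (word w)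
word-nonNegative []      = I , ≈-refl , (0≤n , 0≤n , 0≤n , 0≤n)
word-nonNegative (b ∷ w) =
  let Y , y , Y≥0 = letter-nonNegative b
      Z , z , Z≥0 = word-nonNegative w
  in Y ∙ Z , ∙-cong y z , nonNegative-∙ {Y} {Z} Y≥0 Z≥0

-bc≢1 : ∀ b c → 0ℤ * 0ℤ - + b * + c ≢ 1ℤ
-bc≢1 b c e = impossible (b ℕ.* c) (trans (cong (λ i → 0ℤ - i) (ℤₚ.pos-* b c)) e)
  where
  impossible : ∀ n → 0ℤ - + n ≢ 1ℤ
  impossible zero ()
  impossible (suc n) ()

-- Trace 0 would make both diagonal entries 0, and the determinant `- b * c` could not be 1.
nonNegative⇒trace≢0 : ∀ {Z} → NonNegative Z → ∣ trace Z ∣ ≢ 0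
nonNegative⇒trace≢0 {mat (+ 0) (+ b) (+ c) (+ 0) det} _ refl = -bc≢1 b c det

word-trace≢0 : ∀ w → ∣ trace (word w) ∣ ≢ 0
word-trace≢0 w e with Z , z , Z≥0 ← word-nonNegative w =
  nonNegative⇒trace≢0 {Z} Z≥0 (trans (sym (∣trace∣-cong z)) e)

-- Conjugation by S makes the off-diagonal entries nonpositive.
nonNegative-S-conjugate : ∀ {Y Z} → NonNegative Y → NonNegative Z → Y ↝[ S ] Z → ∣ trace Y ∣ ≡ 2
nonNegative-S-conjugate {mat (+ a) (+ b) (+ c) (+ d) det} {mat (+ a′) (+ b′) (+ c′) (+ d′) _} _ _ =
  go
  where
  vanishes : ∀ m n → + m ≡ - (+ n) → m ≡ 0
  vanishes zero n e = refl
  vanishes (suc m) zero ()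
  vanishes (suc m) (suc n) ()

  x·0+y : ∀ x y → x * 0ℤ + y * 1ℤ ≡ y
  x·0+y = solve-∀
  x·-1+y·0 : ∀ x y → x * -1ℤ + y * 0ℤ ≡ - x
  x·-1+y·0 = solve-∀
  0·x-y : ∀ x y → 0ℤ * x + -1ℤ * y ≡ - y
  0·x-y = solve-∀
  x+0·y : ∀ x y → 1ℤ * x + 0ℤ * y ≡ x
  x+0·y = solve-∀

  diagonal : ∀ a b c d → + a * + d - + b * + c ≡ 1ℤ → b ≡ 0 → c ≡ 0 → ∣ + a + + d ∣ ≡ 2
  diagonal a b c d det refl refl
    with i*j≡1⇒i≡j≡±1 (+ a) (+ d) (trans (lem (+ a) (+ d)) det)
    where
    lem : ∀ a d → a * d ≡ a * d - 0ℤ * 0ℤ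
    lem = solve-∀
  ... | inj₁ (refl , refl) = refl

  antidiagonal : ∀ a b c d → + a * + d - + b * + c ≡ 1ℤ → a ≡ 0 → d ≡ 0 → ⊥
  antidiagonal a b c d det refl refl = -bc≢1 b c det

  go : mat (+ a) (+ b) (+ c) (+ d) det ↝[ S ] mat (+ a′) (+ b′) (+ c′) (+ d′) _ → ∣ + a + + d ∣ ≡ 2
  go (same (e₁ , _ , _ , e₄)) = diagonal a b c d det
    (vanishes b c′ (trans (sym (x·0+y (+ a) (+ b))) (trans e₁ (0·x-y (+ a′) (+ c′)))))
    (vanishes c b′ (trans (sym (ℤₚ.neg-involutive (+ c)))
      (cong -_ (trans (sym (x·-1+y·0 (+ c) (+ d))) (trans e₄ (x+0·y (+ b′) (+ d′)))))))
  -- With the other sign it is the diagonal of `Y` that must vanish, which the determinant forbids.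
  go (opp (_ , e₂ , e₃ , _)) = ⊥-elim (antidiagonal a b c d det
    (vanishes a d′ (trans (sym (ℤₚ.neg-involutive (+ a)))
      (trans (cong -_ (trans (sym (x·-1+y·0 (+ a) (+ b))) e₂))
      (trans (ℤₚ.neg-involutive _) (0·x-y (+ b′) (+ d′))))))
    (vanishes d a′ (trans (sym (x·0+y (+ c) (+ d))) (trans e₃ (cong -_ (x+0·y (+ a′) (+ c′)))))))

-- Axes

exit-∙ : ∀ b A W → A ∙ exit 𝓕 b W ≈ exit 𝓕 b (A ∙ W)
exit-∙ outer A W = ≈-sym (∙-assoc A W R)
exit-∙ inner A W = ≈-trans (≈-sym (∙-assoc A (W ∙ R) R)) (∙-congʳ R (≈-sym (∙-assoc A W R)))

exit-cong : ∀ b {W W′} → W ≈ W′ → exit 𝓕 b W ≈ exit 𝓕 b W′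
exit-cong outer e = ∙-congʳ R e
exit-cong inner e = ∙-congʳ R (∙-congʳ R e)

exit-swap : ∀ b W → exit 𝓕 (swap b) (exit 𝓕 b W) ≈ W
exit-swap outer W = ·R³ W
exit-swap inner W = ·R³ W

step-∙ : ∀ A {W W′ δ δ′} → Step 𝓕 (W , δ) (W′ , δ′) → Step 𝓕 (A ∙ W , δ) (A ∙ W′ , δ′)
step-∙ A {W} (through-⊗ e)   = through-⊗ (≈-trans (∙-congˡ A e) (≈-sym (∙-assoc A W S)))
step-∙ A {W} (through-• b e) = through-• b (≈-trans (∙-congˡ A e) (exit-∙ b A W))

step-resp : ∀ {V V′ W W′ δ δ′} → V ≈ W → V′ ≈ W′ →
            Step 𝓕 (V , δ) (V′ , δ′) → Step 𝓕 (W , δ) (W′ , δ′)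
step-resp v v′ (through-⊗ e)   = through-⊗ (≈-trans (≈-sym v′) (≈-trans e (∙-congʳ S v)))
step-resp v v′ (through-• b e) = through-• b (≈-trans (≈-sym v′) (≈-trans e (exit-cong b v)))

step-reverse : ∀ {W W′ δ δ′} → Step 𝓕 (W , δ) (W′ , δ′) →
               Step 𝓕 (W′ , opposite δ′) (W , opposite δ)
step-reverse {W} (through-⊗ e)   = through-⊗ (≈-trans (≈-sym (·S² W)) (∙-congʳ S (≈-sym e)))
step-reverse {W} (through-• b e) =
  through-• (swap b) (≈-trans (≈-sym (exit-swap b W)) (exit-cong (swap b) (≈-sym e)))

opposite-involutive : ∀ δ → opposite (opposite δ) ≡ δ
opposite-involutive ⟶• = refl
opposite-involutive ⟶⊗ = refl

onAxis-resp : ∀ {M W W′ δ} → W ≈ W′ → OnAxis M (W , δ) → OnAxis M (W′ , δ)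
onAxis-resp e (ℓ , k , f , d) = ℓ , k , ≈-trans f e , d

-- `OnAxis` ranges over all axes of `M`, so the path translated by an element of the centralizer is
-- itself the witness.
onAxis-translate : ∀ {M W δ} A → A ∙ M ≈ M ∙ A → OnAxis M (W , δ) → OnAxis M (A ∙ W , δ)
onAxis-translate {M} A AM≈MA (ℓ , k , e , d) = ℓ′ , k , ∙-congˡ A e , d
  where
  open Axis ℓ
  ℓ′ : Axis M
  ℓ′ = record
    { edge = λ k → A ∙ edge k
    ; dir  = dir
    ; step = λ k → step-∙ A (step k)
    ; period = period
    ; period-nonZero = period-nonZero
    ; translates = λ k → (begin
        M ∙ (A ∙ edge k)      ≈⟨ ∙-assoc M A (edge k) ⟨
        M ∙ A ∙ edge k        ≈⟨ ∙-congʳ (edge k) AM≈MA ⟨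
        A ∙ M ∙ edge k        ≈⟨ ∙-assoc A M (edge k) ⟩
        A ∙ (M ∙ edge k)      ≈⟨ ∙-congˡ A (proj₁ (translates k)) ⟩
        A ∙ edge (k + + period) ∎) , proj₂ (translates k)
    }
    where open ≈-Reasoning

-- From M A M = A it follows that `M` moves the image of the path under `A` backwards, so forwards
-- once the path is traversed from `k` to `- k`.
onAxis-reverse : ∀ {M W δ} A → Inverts A M → OnAxis M (W , δ) → OnAxis M (A ∙ W , opposite δ)
onAxis-reverse {M} A inverts (ℓ , k , e , d) =
  ℓ′ , - k ,
  ∙-congˡ A (≈-trans (≈-reflexive (cong edge (ℤₚ.neg-involutive k))) e) ,
  cong opposite (trans (cong dir (ℤₚ.neg-involutive k)) d)
  where
  open Axis ℓ
  ≈-reflexive : ∀ {A B} → A ≡ B → A ≈ B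
  ≈-reflexive refl = ≈-refl
  predecessor : ∀ k n → - (k + n) + n ≡ - k
  predecessor = solve-∀
  ℓ′ : Axis M
  ℓ′ = record
    { edge = λ k → A ∙ edge (- k)
    ; dir  = λ k → opposite (dir (- k))
    ; step = λ k → step-∙ A (step-reverse
        (subst (λ i → Step 𝓕 (edge (- (k + 1ℤ)) , dir (- (k + 1ℤ))) (edge i , dir i))
               (predecessor k 1ℤ) (step (- (k + 1ℤ)))))
    ; period = period
    ; period-nonZero = period-nonZero
    ; translates = λ k →
        let k′ = - (k + + period)
            back = predecessor k (+ period)
            edge-back = ≈-trans (proj₁ (translates k′)) (≈-reflexive (cong edge back))
        in (begin
          M ∙ (A ∙ edge (- k))             ≈⟨ ∙-assoc M A (edge (- k)) ⟨
          M ∙ A ∙ edge (- k)               ≈⟨ ∙-congˡ (M ∙ A) edge-back ⟨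
          M ∙ A ∙ (M ∙ edge k′)            ≈⟨ ∙-assoc M A (M ∙ edge k′) ⟩
          M ∙ (A ∙ (M ∙ edge k′))          ≈⟨ ∙-congˡ M (∙-assoc A M (edge k′)) ⟨
          M ∙ (A ∙ M ∙ edge k′)            ≈⟨ ∙-congˡ M (∙-congʳ (edge k′) inverts) ⟩
          M ∙ (inv M ∙ A ∙ edge k′)        ≈⟨ ∙-congˡ M (∙-assoc (inv M) A (edge k′)) ⟩
          M ∙ (inv M ∙ (A ∙ edge k′))      ≈⟨ ∙-assoc M (inv M) (A ∙ edge k′) ⟨
          M ∙ inv M ∙ (A ∙ edge k′)        ≈⟨ ∙-congʳ (A ∙ edge k′) (inverseʳ M) ⟩
          I ∙ (A ∙ edge k′)                ≈⟨ identityˡ (A ∙ edge k′) ⟩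
          A ∙ edge k′                      ∎)
        , cong opposite (sym (trans (proj₂ (translates k′)) (cong dir back)))
    }
    where open ≈-Reasoning

-- The edge directed towards its •-vertex on the path: the current or the next one.
base : SL₂ℤ × Direction → SL₂ℤ
base (W , ⟶•) = W
base (W , ⟶⊗) = W ∙ S

_⟶_ : SL₂ℤ → SL₂ℤ → Set
V ⟶ W = ∃[ w ] W ≈ V ∙ word w

step-base : ∀ {x y} → Step 𝓕 x y → base x ⟶ base y
step-base (through-⊗ {e} {e′} f) = [] , ≈-trans f (≈-sym (identityʳ (e ∙ S)))
step-base (through-• {e} {e′} b f) = b ∷ [] , (begin
  e′ ∙ S                      ≈⟨ ∙-congʳ S (≈-trans f (exit-rotation b e)) ⟩
  e ∙ rotation b ∙ S          ≈⟨ ∙-assoc e (rotation b) S ⟩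
  e ∙ letter b                ≈⟨ ∙-congˡ e (identityʳ (letter b)) ⟨
  e ∙ (letter b ∙ I)          ∎)
  where open ≈-Reasoning

⟶-trans : ∀ {U V W} → U ⟶ V → V ⟶ W → U ⟶ W
⟶-trans {U} {V} {W} (v , e) (w , f) = v ++ w , (begin
  W                       ≈⟨ f ⟩
  V ∙ word w              ≈⟨ ∙-congʳ (word w) e ⟩
  U ∙ word v ∙ word w     ≈⟨ ∙-assoc U (word v) (word w) ⟩
  U ∙ (word v ∙ word w)   ≈⟨ ∙-congˡ U (word-++ v w) ⟨
  U ∙ word (v ++ w)       ∎)
  where open ≈-Reasoning

base-cong : ∀ {W W′} δ → W ≈ W′ → base (W , δ) ≈ base (W′ , δ)
base-cong ⟶• e = e
base-cong ⟶⊗ e = ∙-congʳ S e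

base-∙ : ∀ A W δ → A ∙ base (W , δ) ≈ base (A ∙ W , δ)
base-∙ A W ⟶• = ≈-refl
base-∙ A W ⟶⊗ = ≈-sym (∙-assoc A W S)

-- Following the path for one period multiplies the base by the word of its turns on the right; it
-- also multiplies it by `M` on the left.
onAxis⇒word : ∀ {M W δ} → OnAxis M (W , δ) → ∃[ w ] M ↝[ base (W , δ) ] word w
onAxis⇒word {M} {W} (ℓ , k , e , refl) with forward period
  where
  open Axis ℓ
  x : ℤ → SL₂ℤ × Direction
  x k = edge k , dir k
  forward : ∀ n → base (x k) ⟶ base (x (k + + n))
  forward zero = subst (λ i → base (x k) ⟶ base (x i)) (sym (ℤₚ.+-identityʳ k))
    ([] , ≈-sym (identityʳ (base (x k))))
  forward (suc n) = subst (λ i → base (x k) ⟶ base (x i)) (lem k (+ n))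
    (⟶-trans (forward n) (step-base (step (k + + n))))
    where
    lem : ∀ k n → k + n + 1ℤ ≡ k + (1ℤ + n)
    lem = solve-∀
... | w , f = w , (begin
  M ∙ base (W , dir k)                ≈⟨ base-∙ M W (dir k) ⟩
  base (M ∙ W , dir k)                ≈⟨ base-cong (dir k) (∙-congˡ M e) ⟨
  base (M ∙ edge k , dir k)           ≈⟨ base-cong (dir k) (proj₁ (translates k)) ⟩
  base (edge (k + + period) , dir k)  ≡⟨ cong (λ δ → base (edge (k + + period) , δ)) (proj₂ (translates k)) ⟩
  base (edge (k + + period) , dir (k + + period)) ≈⟨ f ⟩
  base (edge k , dir k) ∙ word w      ≈⟨ ∙-congʳ (word w) (base-cong (dir k) e) ⟩
  base (W , dir k) ∙ word w           ∎)
  where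
  open Axis ℓ
  open ≈-Reasoning

-- The bases of the two directions of an edge differ by `S`. The words read in the two directions
-- would thus be conjugate by `S`, and as both are nonnegative up to sign, `M` would have trace ±2.
onAxis-unidirectional : ∀ {M W δ} → Hyperbolic M → OnAxis M (W , δ) → ¬ OnAxis M (W , opposite δ)
onAxis-unidirectional {M} {W} {δ} hyp = go δ
  where
  lem : OnAxis M (W , ⟶•) → OnAxis M (W , ⟶⊗) → ⊥
  lem a a′ with onAxis⇒word a | onAxis⇒word a′
  ... | v , e | w , f with word-nonNegative v | word-nonNegative w
  ... | Y , y , Y≥0 | Z , z , Z≥0 =
    ℕₚ.<⇒≢ hyp (sym (trans (∣trace∣-inter e) (trans (∣trace∣-cong y)
      (nonNegative-S-conjugate Y≥0 Z≥0 (≈-trans (∙-congʳ S (≈-sym y)) (≈-trans conj (∙-congˡ S z)))))))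
    where
    conj : word v ↝[ S ] word w
    conj = ∙-cancelˡ W _ _ (begin
      W ∙ (word v ∙ S)   ≈⟨ ∙-assoc W (word v) S ⟨
      W ∙ word v ∙ S     ≈⟨ ∙-congʳ S e ⟨
      M ∙ W ∙ S          ≈⟨ ∙-assoc M W S ⟩
      M ∙ (W ∙ S)        ≈⟨ f ⟩
      W ∙ S ∙ word w     ≈⟨ ∙-assoc W S (word w) ⟩
      W ∙ (S ∙ word w)   ∎)
      where open ≈-Reasoning
  go : ∀ δ → OnAxis M (W , δ) → OnAxis M (W , opposite δ) → ⊥
  go ⟶• a a′ = lem a a′
  go ⟶⊗ a a′ = lem a′ a

-- Construction of an axis from a word

infixl 8 _^_
_^_ : SL₂ℤ → ℕ → SL₂ℤ
A ^ zero  = I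
A ^ suc n = A ∙ A ^ n

^-+ : ∀ A m n → A ^ (m ℕ.+ n) ≈ A ^ m ∙ A ^ n
^-+ A zero    n = ≈-sym (identityˡ (A ^ n))
^-+ A (suc m) n = ≈-trans (∙-congˡ A (^-+ A m n)) (≈-sym (∙-assoc A (A ^ m) (A ^ n)))

^-comm : ∀ A m n → A ^ m ∙ A ^ n ≈ A ^ n ∙ A ^ m
^-comm A m n = ≈-trans (≈-sym (^-+ A m n))
  (subst (λ k → A ^ k ≈ A ^ n ∙ A ^ m) (ℕₚ.+-comm n m) (^-+ A n m))

-- A forward path that M shifts by its period extends backwards: position k
-- is M⁻ᵐ applied to position k + m period of the path, for any large m.
module _ {M : SL₂ℤ} (e : ℕ → SL₂ℤ) (d : ℕ → Direction) (P′ : ℕ)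
         (e-step : ∀ n → Step 𝓕 (e n , d n) (e (suc n) , d (suc n)))
         (shift : ∀ n → M ∙ e n ≈ e (suc P′ ℕ.+ n) × d n ≡ d (suc P′ ℕ.+ n)) where
  private
    P : ℕ
    P = suc P′

    M⁻¹ : SL₂ℤ
    M⁻¹ = inv M

    shift-back : ∀ j n → e n ≈ M⁻¹ ^ j ∙ e (j ℕ.* P ℕ.+ n) × d n ≡ d (j ℕ.* P ℕ.+ n)
    shift-back zero    n = ≈-sym (identityˡ (e n)) , refl
    shift-back (suc j) n = (begin
      e n                                          ≈⟨ proj₁ (shift-back j n) ⟩
      M⁻¹ ^ j ∙ e n′                               ≈⟨ ∙-congˡ (M⁻¹ ^ j) (identityˡ (e n′)) ⟨
      M⁻¹ ^ j ∙ (I ∙ e n′)                         ≈⟨ ∙-congˡ (M⁻¹ ^ j) (∙-congʳ (e n′) (inverseˡ M)) ⟨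
      M⁻¹ ^ j ∙ (M⁻¹ ∙ M ∙ e n′)                   ≈⟨ ∙-congˡ (M⁻¹ ^ j) (∙-assoc M⁻¹ M (e n′)) ⟩
      M⁻¹ ^ j ∙ (M⁻¹ ∙ (M ∙ e n′))                 ≈⟨ ∙-assoc (M⁻¹ ^ j) M⁻¹ (M ∙ e n′) ⟨
      M⁻¹ ^ j ∙ M⁻¹ ∙ (M ∙ e n′)                   ≈⟨ ∙-cong comm (proj₁ (shift n′)) ⟩
      M⁻¹ ∙ M⁻¹ ^ j ∙ e (P ℕ.+ n′)                 ≡⟨ cong (λ i → M⁻¹ ∙ M⁻¹ ^ j ∙ e i) assoc ⟩
      M⁻¹ ∙ M⁻¹ ^ j ∙ e (P ℕ.+ j ℕ.* P ℕ.+ n)      ∎) ,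
      trans (proj₂ (shift-back j n)) (trans (proj₂ (shift n′)) (cong d assoc))
      where
      open ≈-Reasoning
      n′ : ℕ
      n′ = j ℕ.* P ℕ.+ n
      assoc : P ℕ.+ n′ ≡ P ℕ.+ j ℕ.* P ℕ.+ n
      assoc = sym (ℕₚ.+-assoc P (j ℕ.* P) n)
      comm : M⁻¹ ^ j ∙ M⁻¹ ≈ M⁻¹ ∙ M⁻¹ ^ j
      comm = begin
        M⁻¹ ^ j ∙ M⁻¹      ≈⟨ ∙-congˡ (M⁻¹ ^ j) (identityʳ M⁻¹) ⟨
        M⁻¹ ^ j ∙ M⁻¹ ^ 1  ≈⟨ ^-comm M⁻¹ j 1 ⟩
        M⁻¹ ^ 1 ∙ M⁻¹ ^ j  ≈⟨ ∙-congʳ (M⁻¹ ^ j) (identityʳ M⁻¹) ⟩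
        M⁻¹ ∙ M⁻¹ ^ j      ∎

    -- The hypothesis is n - m P = n′ - m′ P without subtraction: two descriptions of one position.
    -- Shifting `e n` by `m′` periods and `e n′` by `m` reaches the same edge of the forward path.
    independent : ∀ {m n m′ n′} → m′ ℕ.* P ℕ.+ n ≡ m ℕ.* P ℕ.+ n′ →
                  M⁻¹ ^ m ∙ e n ≈ M⁻¹ ^ m′ ∙ e n′ × d n ≡ d n′
    independent {m} {n} {m′} {n′} eq = (begin
      M⁻¹ ^ m ∙ e n                                 ≈⟨ ∙-congˡ (M⁻¹ ^ m) (proj₁ (shift-back m′ n)) ⟩
      M⁻¹ ^ m ∙ (M⁻¹ ^ m′ ∙ e (m′ ℕ.* P ℕ.+ n))     ≈⟨ ∙-assoc (M⁻¹ ^ m) (M⁻¹ ^ m′) _ ⟨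
      M⁻¹ ^ m ∙ M⁻¹ ^ m′ ∙ e (m′ ℕ.* P ℕ.+ n)       ≈⟨ ∙-congʳ _ (^-comm M⁻¹ m m′) ⟩
      M⁻¹ ^ m′ ∙ M⁻¹ ^ m ∙ e (m′ ℕ.* P ℕ.+ n)       ≡⟨ cong (λ i → M⁻¹ ^ m′ ∙ M⁻¹ ^ m ∙ e i) eq ⟩
      M⁻¹ ^ m′ ∙ M⁻¹ ^ m ∙ e (m ℕ.* P ℕ.+ n′)       ≈⟨ ∙-assoc (M⁻¹ ^ m′) (M⁻¹ ^ m) _ ⟩
      M⁻¹ ^ m′ ∙ (M⁻¹ ^ m ∙ e (m ℕ.* P ℕ.+ n′))     ≈⟨ ∙-congˡ (M⁻¹ ^ m′) (proj₁ (shift-back m n′)) ⟨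
      M⁻¹ ^ m′ ∙ e n′                               ∎) ,
      trans (proj₂ (shift-back m′ n)) (trans (cong d eq) (sym (proj₂ (shift-back m n′))))
      where open ≈-Reasoning

    -- As `P` is at least 1, adding `∣ k ∣` periods to `k` gives a natural number; for k = -m it is
    -- m P - m = m `P′`.
    lift : ℤ → ℕ
    lift (+ n)    = n ℕ.* P ℕ.+ n
    lift -[1+ n ] = suc n ℕ.* P′

    lift-spec : ∀ k → + ∣ k ∣ * + P + k ≡ + lift k
    lift-spec (+ n) = cong (λ i → i + + n) (sym (ℤₚ.pos-* n P))
    lift-spec -[1+ n ] = trans (lem (+ suc n) (+ P′)) (sym (ℤₚ.pos-* (suc n) P′))
      where
      lem : ∀ n p → n * (1ℤ + p) - n ≡ n * p
      lem = solve-∀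

    edge : ℤ → SL₂ℤ
    edge k = M⁻¹ ^ ∣ k ∣ ∙ e (lift k)

    dir : ℤ → Direction
    dir k = d (lift k)

    position : ∀ {k m n} → + m * + P + k ≡ + n → edge k ≈ M⁻¹ ^ m ∙ e n × dir k ≡ d n
    position {k} {m} {n} eq = independent {∣ k ∣} {lift k} {m} {n} (ℤₚ.+-injective (begin
      + (m ℕ.* P) + + lift k                  ≡⟨ cong₂ _+_ (ℤₚ.pos-* m P) (sym (lift-spec k)) ⟩
      + m * + P + (+ ∣ k ∣ * + P + k)         ≡⟨ lem (+ m * + P) (+ ∣ k ∣ * + P) k ⟩
      + ∣ k ∣ * + P + (+ m * + P + k)         ≡⟨ cong₂ _+_ (sym (ℤₚ.pos-* ∣ k ∣ P)) eq ⟩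
      + (∣ k ∣ ℕ.* P) + + n                   ∎))
      where
      open ≡-Reasoning
      lem : ∀ i j k → i + (j + k) ≡ j + (i + k)
      lem = solve-∀

    position-+ : ∀ k j → edge (k + + j) ≈ M⁻¹ ^ ∣ k ∣ ∙ e (j ℕ.+ lift k) × dir (k + + j) ≡ d (j ℕ.+ lift k)
    position-+ k j = position {k + + j} {∣ k ∣} (trans (lem (+ ∣ k ∣ * + P) k (+ j)) (cong (λ i → + j + i) (lift-spec k)))
      where
      lem : ∀ i k j → i + (k + j) ≡ j + (i + k)
      lem = solve-∀

  extend : Axis M
  extend = record
    { edge = edge
    ; dir  = dir
    ; step = λ k →
        let e′ , d′ = position-+ k 1 in
        subst (λ δ → Step 𝓕 (edge k , dir k) (edge (k + 1ℤ) , δ)) (sym d′)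
          (step-resp ≈-refl (≈-sym e′) (step-∙ (M⁻¹ ^ ∣ k ∣) (e-step (lift k))))
    ; period = P
    ; period-nonZero = _
    ; translates = λ k →
        let e′ , d′ = position-+ k P
            n = lift k
            A = M⁻¹ ^ ∣ k ∣
        in (begin
          M ∙ (A ∙ e n)          ≈⟨ ∙-assoc M A (e n) ⟨
          M ∙ A ∙ e n            ≈⟨ ∙-congʳ (e n) (M-comm ∣ k ∣) ⟩
          A ∙ M ∙ e n            ≈⟨ ∙-assoc A M (e n) ⟩
          A ∙ (M ∙ e n)          ≈⟨ ∙-congˡ A (proj₁ (shift n)) ⟩
          A ∙ e (P ℕ.+ n)        ≈⟨ e′ ⟨
          edge (k + + P)         ∎)
        , trans (proj₂ (shift n)) (sym d′)
    }
    where
    open ≈-Reasoning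
    M-comm : ∀ n → M ∙ M⁻¹ ^ n ≈ M⁻¹ ^ n ∙ M
    M-comm zero    = ≈-sym (inter-I M)
    M-comm (suc n) = ≈-sym (inter-∙ (≈-trans (inverseˡ M) (≈-sym (inverseʳ M))) (≈-sym (M-comm n)))

State : Set
State = List Side × SL₂ℤ × Direction

-- The list is a queue of turns, each put back at the end once taken, so that a finite word steers
-- an infinite path. The turn `outer` on an empty queue is a default, never reached from a nonempty
-- one.
advance : State → State
advance (w     , W , ⟶⊗) = w , W ∙ S , ⟶•
advance ([]    , W , ⟶•) = [] , exit 𝓕 outer W , ⟶⊗
advance (b ∷ w , W , ⟶•) = w ∷ʳ b , exit 𝓕 b W , ⟶⊗

walk : ℕ → State → State
walk zero    x = x
walk (suc n) x = walk n (advance x)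

walk-+ : ∀ m n x → walk (m ℕ.+ n) x ≡ walk n (walk m x)
walk-+ zero    n x = refl
walk-+ (suc m) n x = walk-+ m n (advance x)

walk-step : ∀ n x → Step 𝓕 (proj₂ (walk n x)) (proj₂ (walk (suc n) x))
walk-step zero    (w     , W , ⟶⊗) = through-⊗ ≈-refl
walk-step zero    ([]    , W , ⟶•) = through-• outer ≈-refl
walk-step zero    (b ∷ w , W , ⟶•) = through-• b ≈-refl
walk-step (suc n) x = walk-step n (advance x)

-- Walking is determined by queue and direction and commutes with left multiplication, so one
-- coincidence after a period propagates to the whole walk.
data Translated (M : SL₂ℤ) : State → State → Set where
  translated : ∀ {w W W′ δ} → M ∙ W ≈ W′ → Translated M (w , W , δ) (w , W′ , δ)

walk-translated : ∀ n {M x y} → Translated M x y → Translated M (walk n x) (walk n y)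
walk-translated zero    t = t
walk-translated (suc n) t = walk-translated n (advance-translated t)
  where
  advance-translated : ∀ {M x y} → Translated M x y → Translated M (advance x) (advance y)
  advance-translated {M} (translated {w} {W} {δ = ⟶⊗} e) =
    translated (≈-trans (≈-sym (∙-assoc M W S)) (∙-congʳ S e))
  advance-translated {M} (translated {[]} {W} {δ = ⟶•} e) =
    translated (≈-trans (exit-∙ outer M W) (exit-cong outer e))
  advance-translated {M} (translated {b ∷ w} {W} {δ = ⟶•} e) =
    translated (≈-trans (exit-∙ b M W) (exit-cong b e))

-- A letter takes two steps, one through each kind of vertex. The tail `v` collects the letters
-- already used, as the induction requires.
walk-word : ∀ u v W → ∃[ W′ ] walk (length u ℕ.* 2) (u ++ v , W , ⟶•) ≡ (v ++ u , W′ , ⟶•) × W′ ≈ W ∙ word u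
walk-word [] v W = W , cong (_, W , ⟶•) (sym (Listₚ.++-identityʳ v)) , ≈-sym (identityʳ W)
walk-word (b ∷ u) v W with walk-word u (v ∷ʳ b) (exit 𝓕 b W ∙ S)
... | W′ , eq , e = W′ ,
  trans (cong (λ w → walk (length u ℕ.* 2) (w , exit 𝓕 b W ∙ S , ⟶•)) (Listₚ.++-assoc u v (b ∷ [])))
    (trans eq (cong (_, W′ , ⟶•) (Listₚ.++-assoc v (b ∷ []) u))) ,
  (begin
    W′                          ≈⟨ e ⟩
    exit 𝓕 b W ∙ S ∙ word u     ≈⟨ ∙-congʳ (word u) (∙-congʳ S (exit-rotation b W)) ⟩
    W ∙ rotation b ∙ S ∙ word u ≈⟨ ∙-congʳ (word u) (∙-assoc W (rotation b) S) ⟩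
    W ∙ letter b ∙ word u       ≈⟨ ∙-assoc W (letter b) (word u) ⟩
    W ∙ (letter b ∙ word u)     ∎)
  where open ≈-Reasoning

wordAxis : ∀ {M V} b w → M ↝[ V ] word (b ∷ w) → Axis M
wordAxis {M} {V} b w e = extend (λ n → proj₁ (proj₂ (walk n x))) (λ n → proj₂ (proj₂ (walk n x)))
  -- `extend` expects the predecessor of the period, here of `length (b ∷ w) ℕ.* 2`.
  (suc (length w ℕ.* 2)) (λ n → walk-step n x) shift
  where
  x : State
  x = b ∷ w , V , ⟶•

  P : ℕ
  P = length (b ∷ w) ℕ.* 2

  loop : Translated M x (walk P x)
  loop with walk-word (b ∷ w) [] V
  ... | W′ , eq , f = subst (Translated M x)
    (trans (sym eq) (cong (λ u → walk P (b ∷ u , V , ⟶•)) (Listₚ.++-identityʳ w)))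
    (translated (≈-trans e (≈-sym f)))

  project : ∀ {y z} → Translated M y z →
            M ∙ proj₁ (proj₂ y) ≈ proj₁ (proj₂ z) × proj₂ (proj₂ y) ≡ proj₂ (proj₂ z)
  project (translated f) = f , refl

  shift : ∀ n → M ∙ proj₁ (proj₂ (walk n x)) ≈ proj₁ (proj₂ (walk (P ℕ.+ n) x))
              × proj₂ (proj₂ (walk n x)) ≡ proj₂ (proj₂ (walk (P ℕ.+ n) x))
  shift n = project (subst (Translated M (walk n x)) (sym (walk-+ P n x)) (walk-translated n loop))

axis : ∀ M → Hyperbolic M → Axis M
axis M hyp with reducible M
... | _ , (V , e) , isI = ⊥-elim (ℕₚ.<-irrefl (sym (∣trace∣-inter e)) hyp)
... | _ , (V , e) , isS = ⊥-elim (elliptic (∣trace∣-inter e) hyp)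
  where
  elliptic : ∀ {n} → n ≡ 0 → ¬ (2 ℕ.< n)
  elliptic refl ()
... | _ , (V , e) , rotates b = ⊥-elim (elliptic b (∣trace∣-inter e) hyp)
  where
  elliptic : ∀ {n} b → n ≡ ∣ trace (rotation b) ∣ → ¬ (2 ℕ.< n)
  elliptic inner refl (ℕ.s≤s ())
  elliptic outer refl (ℕ.s≤s ())
... | _ , (V , e) , isWord b w = wordAxis b w e

trace≡0⇒conjugate-S : ∀ U → ∣ trace U ∣ ≡ 0 → Conjugate U S
trace≡0⇒conjugate-S U tr≡0 with reducible U
... | _ , (V , e) , isI with () ← trans (sym tr≡0) (∣trace∣-inter e)
... | _ , (V , e) , isS = V , e
... | _ , (V , e) , rotates outer with () ← trans (sym tr≡0) (∣trace∣-inter e)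
... | _ , (V , e) , rotates inner with () ← trans (sym tr≡0) (∣trace∣-inter e)
... | _ , (V , e) , isWord b w = ⊥-elim (word-trace≢0 (b ∷ w) (trans (sym (∣trace∣-inter e)) tr≡0))

-- Powers of a hyperbolic matrix

commutes-with-generator : ∀ {M N} → ⟨ M ⟩ N → N ∙ M ≈ M ∙ N
commutes-with-generator gen       = ≈-refl
commutes-with-generator {M} unit  = inter-I M
commutes-with-generator (mul x y) = inter-∙ (commutes-with-generator x) (commutes-with-generator y)
commutes-with-generator (inve x)  = inter-inv (commutes-with-generator x)

-- `A` normalizes the group generated by `M`; this lets left multiplication by `A` descend to the
-- quotient of the tree.
conjugate-power : ∀ {A M N} → Inverts A M → ⟨ M ⟩ N → ∃[ N′ ] ⟨ M ⟩ N′ × N′ ↝[ A ] N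
conjugate-power {M = M} inverts gen = inv M , inve gen , ≈-sym inverts
conjugate-power {A} inverts unit = I , unit , inter-I A
conjugate-power inverts (mul x y) =
  let X , x′ , e = conjugate-power inverts x
      Y , y′ , f = conjugate-power inverts y
  in X ∙ Y , mul x′ y′ , inter-∙ e f
conjugate-power inverts (inve x) =
  let X , x′ , e = conjugate-power inverts x
  in inv X , inve x′ , inter-inv e

-- N is a linear combination of I and M, with coefficient b at M.
Combination : SL₂ℤ → SL₂ℤ → ℤ → Set
Combination M N b = N.q ≡ b * M.q × N.r ≡ b * M.r × N.s ≡ N.p + b * (M.s - M.p)
  where module M = SL₂ℤ M
        module N = SL₂ℤ N

-- By Cayley-Hamilton the span of `I` and `M` is closed under products. The inverse of a matrix of
-- determinant 1 is its trace times `I` minus the matrix, which negates `b`.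
power-combination : ∀ {M N} → ⟨ M ⟩ N → ∃[ b ] Combination M N b
power-combination {mat p q r s _} gen =
  1ℤ , sym (ℤₚ.*-identityˡ q) , sym (ℤₚ.*-identityˡ r) , lem p s
  where
  lem : ∀ p s → s ≡ p + 1ℤ * (s - p)
  lem = solve-∀
power-combination unit = 0ℤ , refl , refl , refl
power-combination {M@(mat p q r s _)} (mul {A} {B} x y) =
  product A B (power-combination x) (power-combination y)
  where
  product : ∀ A B → ∃[ b ] Combination M A b → ∃[ c ] Combination M B c → ∃[ d ] Combination M (A ∙ B) d
  product (mat a _ _ _ _) (mat a′ _ _ _ _) (b , refl , refl , refl) (c , refl , refl , refl) =
    a * c + b * (a′ + c * (s - p)) ,
    lem₁ p q s a a′ b c , lem₂ p r s a a′ b c , lem₃ p q r s a a′ b c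
    where
    lem₁ : ∀ p q s a a′ b c →
      a * (c * q) + b * q * (a′ + c * (s - p)) ≡ (a * c + b * (a′ + c * (s - p))) * q
    lem₁ = solve-∀
    lem₂ : ∀ p r s a a′ b c →
      b * r * a′ + (a + b * (s - p)) * (c * r) ≡ (a * c + b * (a′ + c * (s - p))) * r
    lem₂ = solve-∀
    lem₃ : ∀ p q r s a a′ b c →
      b * r * (c * q) + (a + b * (s - p)) * (a′ + c * (s - p))
      ≡ a * a′ + b * q * (c * r) + (a * c + b * (a′ + c * (s - p))) * (s - p)
    lem₃ = solve-∀
power-combination {M@(mat p q r s _)} (inve {A} x) = inverse A (power-combination x)
  where
  inverse : ∀ A → ∃[ b ] Combination M A b → ∃[ c ] Combination M (inv A) c
  inverse (mat a _ _ _ _) (b , refl , refl , refl) =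
    - b , ℤₚ.neg-distribˡ-* b q , ℤₚ.neg-distribˡ-* b r , lem a b p s
    where
    lem : ∀ a b p s → a ≡ a + b * (s - p) + - b * (s - p)
    lem = solve-∀

hyperbolic⇒trace²≢4 : ∀ {M} → Hyperbolic M → trace M * trace M ≢ + 4
hyperbolic⇒trace²≢4 {M} hyp e = ℕₚ.<⇒≱ {4} {9} (ℕ.s≤s (ℕ.s≤s (ℕ.s≤s (ℕ.s≤s (ℕ.s≤s ℕ.z≤n)))))
  (ℕₚ.≤-trans (ℕₚ.*-mono-≤ hyp hyp)
    (ℕₚ.≤-reflexive (trans (sym (ℤₚ.abs-* (trace M) (trace M))) (cong ∣_∣ e))))

∣i∣≡∣j∣⇒i*i≡j*j : ∀ i j → ∣ i ∣ ≡ ∣ j ∣ → i * i ≡ j * j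
∣i∣≡∣j∣⇒i*i≡j*j i j e = trans (square i) (trans (cong (λ n → + (n ℕ.* n)) e) (sym (square j)))
  where
  square : ∀ i → i * i ≡ + (∣ i ∣ ℕ.* ∣ i ∣)
  square (+ n)    = sym (ℤₚ.pos-* n n)
  square -[1+ n ] = refl

sum-difference-injective : ∀ i j k l → i + j ≡ k + l → j - i ≡ l - k → i ≡ k × j ≡ l
sum-difference-injective i j k l e f = i≡k , trans (lem′ i j) (trans (cong₂ _-_ e i≡k) (sym (lem′ k l)))
  where
  lem′ : ∀ i j → j ≡ i + j - i
  lem′ = solve-∀
  lem : ∀ i j → + 2 * i ≡ (i + j) - (j - i)
  lem = solve-∀
  i≡k : i ≡ k
  i≡k = ℤₚ.*-cancelˡ-≡ (+ 2) i k (trans (lem i j) (trans (cong₂ _-_ e f) (sym (lem k l))))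

-- The right-hand side is the discriminant of the form (r, s - p, -q). It ignores the scalar part of
-- a matrix, so passing to a combination with coefficient `b` multiplies it by `b * b`.
discriminant : ∀ p q r s → p * s - q * r ≡ 1ℤ →
               (p + s) * (p + s) - + 4 ≡ (s - p) * (s - p) + + 4 * (q * r)
discriminant p q r s det = trans (cong (λ i → (p + s) * (p + s) - + 4 * i) (sym det)) (lem p q r s)
  where
  lem : ∀ p q r s → (p + s) * (p + s) - + 4 * (p * s - q * r) ≡ (s - p) * (s - p) + + 4 * (q * r)
  lem = solve-∀

-- Comparing discriminants t² - 4 shows that the coefficient of M is ±1.
power-same-trace : ∀ {M N} → Hyperbolic M → ⟨ M ⟩ N → ∣ trace N ∣ ≡ ∣ trace M ∣ → N ≈ M ⊎ N ≈ inv M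
power-same-trace {M} {N} hyp n tr = go M N hyp (power-combination n)
  (∣i∣≡∣j∣⇒i*i≡j*j (trace N) (trace M) tr)
  where
  go : ∀ M N → Hyperbolic M → ∃[ b ] Combination M N b → trace N * trace N ≡ trace M * trace M →
       N ≈ M ⊎ N ≈ inv M
  go M@(mat p q r s det) N@(mat a _ _ _ det′) hyp (b , refl , refl , refl) tr²
    with ℤₚ.i*j≡0⇒i≡0∨j≡0 (b * b - 1ℤ) vanishing
    where
    t t′ : ℤ
    t  = trace M
    t′ = trace N
    open ≡-Reasoning
    scale : ∀ a b p q r s → let u = a + b * (s - p) in
            (u - a) * (u - a) + + 4 * (b * q * (b * r)) ≡ b * b * ((s - p) * (s - p) + + 4 * (q * r))
    scale = solve-∀
    vanishing : (b * b - 1ℤ) * (t * t - + 4) ≡ 0ℤ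
    vanishing = begin
      (b * b - 1ℤ) * (t * t - + 4)                        ≡⟨ lem (b * b) (t * t - + 4) ⟩
      b * b * (t * t - + 4) - (t * t - + 4)               ≡⟨ cong₂ _-_ (cong (b * b *_) (discriminant p q r s det)) (cong (_- + 4) (sym tr²)) ⟩
      b * b * ((s - p) * (s - p) + + 4 * (q * r)) - (t′ * t′ - + 4)
        ≡⟨ cong₂ _-_ (sym (scale a b p q r s)) (discriminant a (b * q) (b * r) (a + b * (s - p)) det′) ⟩
      δ - δ                                               ≡⟨ ℤₚ.+-inverseʳ δ ⟩
      0ℤ                                                  ∎
      where
      u = a + b * (s - p)
      δ = (u - a) * (u - a) + + 4 * (b * q * (b * r))
      lem : ∀ i j → (i - 1ℤ) * j ≡ i * j - j
      lem = solve-∀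
  ... | inj₂ t²-4≡0 = ⊥-elim (hyperbolic⇒trace²≢4 {M} hyp (ℤₚ.i-j≡0⇒i≡j _ _ t²-4≡0))
  ... | inj₁ b²-1≡0
    with i*i≡j*j⇒i≡±j b 1ℤ (ℤₚ.i-j≡0⇒i≡j _ _ b²-1≡0) | i*i≡j*j⇒i≡±j (trace N) (trace M) tr²
  -- The signs of `b` and of the trace give the four matrices M, -M⁻¹, M⁻¹ and -M in turn.
  ... | inj₁ refl | inj₁ t =
    let e , f = sum-difference-injective a _ p s t (lem a p s)
    in inj₁ (same (e , ℤₚ.*-identityˡ q , ℤₚ.*-identityˡ r , f))
    where
    lem : ∀ a p s → a + 1ℤ * (s - p) - a ≡ s - p
    lem = solve-∀
  ... | inj₁ refl | inj₂ t =
    let e , f = sum-difference-injective a _ (- s) (- p) (trans t (lem₁ p s)) (lem₂ a p s)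
    in inj₂ (opp (e , lem₃ q , lem₃ r , f))
    where
    lem₁ : ∀ p s → - (p + s) ≡ - s + - p
    lem₁ = solve-∀
    lem₂ : ∀ a p s → a + 1ℤ * (s - p) - a ≡ - p - - s
    lem₂ = solve-∀
    lem₃ : ∀ q → 1ℤ * q ≡ - - q
    lem₃ = solve-∀
  ... | inj₂ refl | inj₁ t =
    let e , f = sum-difference-injective a _ s p (trans t (ℤₚ.+-comm p s)) (lem a p s)
    in inj₂ (same (e , ℤₚ.-1*i≡-i q , ℤₚ.-1*i≡-i r , f))
    where
    lem : ∀ a p s → a + -1ℤ * (s - p) - a ≡ p - s
    lem = solve-∀
  ... | inj₂ refl | inj₂ t =
    let e , f = sum-difference-injective a _ (- p) (- s) (trans t (ℤₚ.neg-distrib-+ p s)) (lem a p s)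
    in inj₁ (opp (e , ℤₚ.-1*i≡-i q , ℤₚ.-1*i≡-i r , f))
    where
    lem : ∀ a p s → a + -1ℤ * (s - p) - a ≡ - s - - p
    lem = solve-∀

-- Elements that invert a hyperbolic matrix

hyperbolic⇒trace≢0 : ∀ {M} → Hyperbolic M → trace M ≢ 0ℤ
hyperbolic⇒trace≢0 hyp e with () ← subst (λ t → 2 ℕ.< ∣ t ∣) e hyp

-- Read entrywise, U M = M⁻¹ U makes the trace of `U` annihilate q, r and s - p, hence the nonzero
-- discriminant of `M`. With the opposite sign it annihilates the trace of `M`.
inverts-hyperbolic⇒trace≡0 : ∀ {U M} → Hyperbolic M → Inverts U M → trace U ≡ 0ℤ
inverts-hyperbolic⇒trace≡0 {mat a b c d _} {M@(mat p q r s det)} hyp (same (e₁ , e₂ , e₃ , e₄))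
  with ℤₚ.i*j≡0⇒i≡0∨j≡0 (a + d) vanishing
  where
  open ≡-Reasoning
  q-vanishes : (a + d) * q ≡ 0ℤ
  q-vanishes = trans (lem a b d q s) (ℤₚ.i≡j⇒i-j≡0 e₂)
    where
    lem : ∀ a b d q s → (a + d) * q ≡ a * q + b * s - (s * b + - q * d)
    lem = solve-∀
  r-vanishes : (a + d) * r ≡ 0ℤ
  r-vanishes = trans (lem a c d p r) (ℤₚ.i≡j⇒i-j≡0 e₃)
    where
    lem : ∀ a c d p r → (a + d) * r ≡ c * p + d * r - (- r * a + p * c)
    lem = solve-∀
  s-p-vanishes : (a + d) * (s - p) ≡ 0ℤ
  s-p-vanishes = trans (lem a b c d p q r s) (cong₂ _-_ (ℤₚ.i≡j⇒i-j≡0 e₄) (ℤₚ.i≡j⇒i-j≡0 e₁))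
    where
    lem : ∀ a b c d p q r s → (a + d) * (s - p) ≡
          (c * q + d * s - (- r * b + p * d)) - (a * p + b * r - (s * a + - q * c))
    lem = solve-∀
  vanishing : (a + d) * ((p + s) * (p + s) - + 4) ≡ 0ℤ
  vanishing = begin
    (a + d) * ((p + s) * (p + s) - + 4)                      ≡⟨ cong ((a + d) *_) (discriminant p q r s det) ⟩
    (a + d) * ((s - p) * (s - p) + + 4 * (q * r))            ≡⟨ lem (a + d) (s - p) q r ⟩
    (a + d) * (s - p) * (s - p) + + 4 * ((a + d) * q * r)    ≡⟨ cong₂ (λ i j → i * (s - p) + + 4 * (j * r)) s-p-vanishes q-vanishes ⟩
    0ℤ * (s - p) + + 4 * (0ℤ * r)                            ≡⟨⟩
    0ℤ                                                       ∎
    where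
    lem : ∀ i j q r → i * (j * j + + 4 * (q * r)) ≡ i * j * j + + 4 * (i * q * r)
    lem = solve-∀
... | inj₁ trace≡0 = trace≡0
... | inj₂ t²-4≡0  = ⊥-elim (hyperbolic⇒trace²≢4 {M} hyp (ℤₚ.i-j≡0⇒i≡j _ _ t²-4≡0))
inverts-hyperbolic⇒trace≡0 {mat a b c d _} {M@(mat p q r s det)} hyp (opp (e₁ , _ , _ , e₄))
  with ℤₚ.i*j≡0⇒i≡0∨j≡0 (a + d) vanishing
  where
  vanishing : (a + d) * (p + s) ≡ 0ℤ
  vanishing = trans (lem a b c d p q r s) (cong₂ _+_ (ℤₚ.i≡j⇒i-j≡0 e₁) (ℤₚ.i≡j⇒i-j≡0 e₄))
    where
    lem : ∀ a b c d p q r s → (a + d) * (p + s) ≡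
          (a * p + b * r - - (s * a + - q * c)) + (c * q + d * s - - (- r * b + p * d))
    lem = solve-∀
... | inj₁ trace≡0 = trace≡0
... | inj₂ t≡0     = ⊥-elim (hyperbolic⇒trace≢0 {M} hyp t≡0)

data Symmetric : SL₂ℤ → Set where
  symmetric : ∀ {p q r s det} → q ≡ r → Symmetric (mat p q r s det)

-- Conjugation by `S` is inverse transposition on SL₂(ℤ). With the opposite sign `Y` would be
-- antisymmetric, hence of trace 0.
symmetric⇔S-inverts : ∀ {Y} → trace Y ≢ 0ℤ → Symmetric Y ⇔ Inverts S Y
symmetric⇔S-inverts {Y@(mat p q r s det)} tr≢0 = mk⇔ to from
  where
  lem₁ : ∀ i j → 0ℤ * i + -1ℤ * j ≡ - j
  lem₁ = solve-∀
  lem₂ : ∀ i j → i * 0ℤ + - j * 1ℤ ≡ - j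
  lem₂ = solve-∀
  lem₃ : ∀ i j → i * -1ℤ + j * 0ℤ ≡ - i
  lem₃ = solve-∀
  lem₄ : ∀ i j → 1ℤ * i + 0ℤ * j ≡ i
  lem₄ = solve-∀
  lem₅ : ∀ i j → i * 0ℤ + j * 1ℤ ≡ j
  lem₅ = solve-∀

  to : Symmetric Y → Inverts S Y
  to (symmetric refl) = same
    ( trans (lem₁ p r) (sym (lem₂ s q))
    , trans (lem₁ q s) (sym (lem₃ s (- q)))
    , trans (lem₄ p r) (sym (lem₅ (- r) p))
    , trans (lem₄ q s) (trans (sym (ℤₚ.neg-involutive q)) (sym (lem₃ (- r) p))) )

  from : Inverts S Y → Symmetric Y
  from (same (e , _ , _ , _)) =
    symmetric (sym (ℤₚ.neg-injective (trans (sym (lem₁ p r)) (trans e (lem₂ s q)))))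
  from (opp (_ , e₂ , e₃ , _)) = ⊥-elim (tr≢0 (cong₂ _+_
    (self-opposite p (trans (sym (lem₄ p r)) (trans e₃ (cong -_ (lem₅ (- r) p)))))
    (self-opposite s (trans (sym (ℤₚ.neg-involutive s)) (cong -_ (trans (sym (lem₁ q s))
      (trans e₂ (trans (cong -_ (lem₃ s (- q))) (ℤₚ.neg-involutive s)))))))))
    where
    self-opposite : ∀ i → i ≡ - i → i ≡ 0ℤ
    self-opposite (+ 0) e = refl

-- The class of forms

∣⇒*-/ : ∀ g i .{{_ : ℤ.NonZero g}} → g ∣ i → g * (i / g) ≡ i
∣⇒*-/ g i g∣i with Signed.∣ᵤ⇒∣ g∣i
... | Signed.divides k eq = begin
  g * (i / g)                     ≡⟨ ℤₚ.*-comm g (i / g) ⟩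
  i / g * g                       ≡⟨ ℤₚ.+-identityˡ (i / g * g) ⟨
  0ℤ + i / g * g                  ≡⟨ cong (λ n → + n + i / g * g) (remainder≡0 ∣ k - i / g ∣ remainder) ⟨
  + (i % g) + i / g * g           ≡⟨ ℤ.a≡a%n+[a/n]*n i g ⟨
  i                               ∎
  where
  open ≡-Reasoning
  remainder : i % g ≡ ∣ k - i / g ∣ ℕ.* ∣ g ∣
  remainder = trans (cong ∣_∣ (begin
    + (i % g)                           ≡⟨ lem (+ (i % g)) (i / g * g) ⟩
    + (i % g) + i / g * g - i / g * g   ≡⟨ cong (_- i / g * g) (trans (sym (ℤ.a≡a%n+[a/n]*n i g)) eq) ⟩
    k * g - i / g * g                   ≡⟨ lem′ k (i / g) g ⟩
    (k - i / g) * g                     ∎)) (ℤₚ.abs-* (k - i / g) g)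
    where
    lem : ∀ i j → i ≡ i + j - j
    lem = solve-∀
    lem′ : ∀ i j k → i * k - j * k ≡ (i - j) * k
    lem′ = solve-∀
  remainder≡0 : ∀ n → i % g ≡ n ℕ.* ∣ g ∣ → i % g ≡ 0
  remainder≡0 zero    e = e
  -- A remainder that is a multiple of `g` but smaller than it must be 0.
  remainder≡0 (suc n) e = ⊥-elim (ℕₚ.<⇒≱ (ℤ.n%d<d i g)
    (subst (∣ g ∣ ℕ.≤_) (sym e) (ℕₚ.m≤m+n ∣ g ∣ (n ℕ.* ∣ g ∣))))

-- The form (r, s - p, -q) sends a vector v to the determinant of the pair v, M v. Replacing v by V
-- v therefore amounts to replacing `M` by V⁻¹ M V, and up to a nonzero factor the outer
-- coefficients of `V · formOf M hyp` are the entries r and -q of that conjugate.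
reciprocalForm⇔symmetric : ∀ V M (hyp : Hyperbolic M) →
  ReciprocalForm (V · formOf M hyp) ⇔ Symmetric (inv V ∙ M ∙ V)
reciprocalForm⇔symmetric V@(mat a b c d _) M@(mat p q r s _) hyp = mk⇔ to from
  where
  open ≡-Reasoning
  ε g : ℤ
  ε = sign (trace M) ◃ 1
  g = content M
  instance
    g≢0 : ℤ.NonZero g
    g≢0 = content-nonZero M hyp

  x y z A C : ℤ
  x = r / g
  y = (s - p) / g
  z = (- q) / g
  A = Form.A (V · formOf M hyp)
  C = Form.C (V · formOf M hyp)

  ε≢0 : ε ≢ 0ℤ
  ε≢0 = sign≢0 (trace M)
    where
    sign≢0 : ∀ t → sign t ◃ 1 ≢ 0ℤ
    sign≢0 (+ n) ()
    sign≢0 -[1+ n ] ()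

  inner∣ : ∀ {i} → gcd q (s - p) ∣ i → g ∣ i
  inner∣ {i} = ℕ.∣-trans (gcd[i,j]∣i (gcd q (s - p)) r)

  gx : g * x ≡ r
  gx = ∣⇒*-/ g r (gcd[i,j]∣j (gcd q (s - p)) r)
  gy : g * y ≡ s - p
  gy = ∣⇒*-/ g (s - p) (inner∣ {s - p} (gcd[i,j]∣j q (s - p)))
  gz : g * z ≡ - q
  gz = ∣⇒*-/ g (- q) (subst (∣ g ∣ ℕ.∣_) (sym (ℤₚ.∣-i∣≡∣i∣ q)) (inner∣ {q} (gcd[i,j]∣i q (s - p))))

  qʸ rʸ : ℤ
  qʸ = SL₂ℤ.q (inv V ∙ M ∙ V)
  rʸ = SL₂ℤ.r (inv V ∙ M ∙ V)

  scaled : g * (A + C) ≡ ε * (rʸ - qʸ)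
  scaled = begin
    g * (A + C)
      ≡⟨ lem₁ ε g x y z a b c d ⟩
    ε * (g * x * (a * a + b * b) + g * y * (a * c + b * d) + g * z * (c * c + d * d))
      ≡⟨ cong (ε *_) (cong₂ _+_ (cong₂ (λ i j → i * (a * a + b * b) + j * (a * c + b * d)) gx gy)
                                (cong (_* (c * c + d * d)) gz)) ⟩
    ε * (r * (a * a + b * b) + (s - p) * (a * c + b * d) + - q * (c * c + d * d))
      ≡⟨ cong (ε *_) (lem₂ p q r s a b c d) ⟩
    ε * (rʸ - qʸ) ∎
    where
    lem₁ : ∀ ε g x y z a b c d →
      g * (ε * x * a * a + ε * y * a * c + ε * z * c * c + (ε * x * b * b + ε * y * b * d + ε * z * d * d))
      ≡ ε * (g * x * (a * a + b * b) + g * y * (a * c + b * d) + g * z * (c * c + d * d))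
    lem₁ = solve-∀
    lem₂ : ∀ p q r s a b c d →
      r * (a * a + b * b) + (s - p) * (a * c + b * d) + - q * (c * c + d * d)
      ≡ (- c * p + a * r) * a + (- c * q + a * s) * c - ((d * p + - b * r) * b + (d * q + - b * s) * d)
    lem₂ = solve-∀

  cancel : ∀ i {j} → i ≢ 0ℤ → i * j ≡ 0ℤ → j ≡ 0ℤ
  cancel i i≢0 e with ℤₚ.i*j≡0⇒i≡0∨j≡0 i e
  ... | inj₁ i≡0 = ⊥-elim (i≢0 i≡0)
  ... | inj₂ j≡0 = j≡0

  to : C ≡ - A → Symmetric (inv V ∙ M ∙ V)
  to e = symmetric (sym (ℤₚ.i-j≡0⇒i≡j rʸ qʸ (cancel ε ε≢0 (begin
    ε * (rʸ - qʸ)   ≡⟨ scaled ⟨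
    g * (A + C)     ≡⟨ cong (λ i → g * (A + i)) e ⟩
    g * (A + - A)   ≡⟨ cong (g *_) (ℤₚ.+-inverseʳ A) ⟩
    g * 0ℤ          ≡⟨ ℤₚ.*-zeroʳ g ⟩
    0ℤ              ∎))))

  from : Symmetric (inv V ∙ M ∙ V) → C ≡ - A
  from (symmetric e) = ℤₚ.i-j≡0⇒i≡j C (- A) (trans (lem A C) (cancel g (λ g≡0 → ℕ.≢-nonZero⁻¹ ∣ g ∣ (cong ∣_∣ g≡0)) (begin
    g * (A + C)     ≡⟨ scaled ⟩
    ε * (rʸ - qʸ)   ≡⟨ cong (ε *_) (ℤₚ.i≡j⇒i-j≡0 (sym e)) ⟩
    ε * 0ℤ          ≡⟨ ℤₚ.*-zeroʳ ε ⟩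
    0ℤ              ∎)))
    where
    lem : ∀ i j → j - - i ≡ i + j
    lem = solve-∀

inverts-inter : ∀ {X X′ Y Y′ V} → X ↝[ V ] X′ → Y ↝[ V ] Y′ → Inverts X Y ⇔ Inverts X′ Y′
inverts-inter x y = mk⇔ (inter-reflects-≈ XY YX) (inter-preserves-≈ XY YX)
  where
  XY = inter-∙ x y
  YX = inter-∙ (inter-inv y) x

-- Isomorphisms of çarks

∼-mul : ∀ {A M W W′} → Inverts A M → W ∼[ M ] W′ → (A ∙ W) ∼[ M ] (A ∙ W′)
∼-mul {A} {M} {W} {W′} inverts (by N n e) with conjugate-power inverts n
... | N′ , n′ , f = by N′ n′ (begin
  N′ ∙ (A ∙ W)   ≈⟨ ∙-assoc N′ A W ⟨
  N′ ∙ A ∙ W     ≈⟨ ∙-congʳ W f ⟩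
  A ∙ N ∙ W      ≈⟨ ∙-assoc A N W ⟩
  A ∙ (N ∙ W)    ≈⟨ ∙-congˡ A e ⟩
  A ∙ W′         ∎)
  where open ≈-Reasoning

-- Since ρ⁴ is ρ, the çark and its image under ᵐ and ʳ have the same ribbon
-- structure, and A need only reverse the spine.
inverting-involution⇒reciprocal : ∀ {A M} → A ∙ A ≈ I → Inverts A M → Reciprocal (çark M)
inverting-involution⇒reciprocal {A} {M} AA≈I inverts = record
  { bijection = record
    { to        = A ∙_
    ; from      = A ∙_
    ; to-cong   = ∼-mul inverts
    ; from-cong = ∼-mul inverts
    ; inverse   = (λ {x} e → ∼-trans (∼-mul inverts e) (involutive x))
                , (λ {x} e → ∼-trans (∼-mul inverts e) (involutive x))
    }
  ; preserves-σ = λ W → ≈⇒∼ (≈-sym (∙-assoc A W S))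
  ; preserves-ρ = λ W → ≈⇒∼ (≈-trans (≈-sym (∙-assoc A W R)) (≈-sym (·R³ (A ∙ W ∙ R))))
  ; preserves-spine = λ W δ → mk⇔
      (λ (V , a , v) → A ∙ V , onAxis-reverse A inverts a , ∼-mul inverts v)
      (λ (V , a , v) → A ∙ V
        , subst (λ δ → OnAxis M (A ∙ V , δ)) (opposite-involutive δ) (onAxis-reverse A inverts a)
        , ∼-trans (∼-mul inverts v) (involutive W))
  }
  where
  involutive : ∀ W → (A ∙ (A ∙ W)) ∼[ M ] W
  involutive W = ≈⇒∼ (≈-trans (≈-sym (∙-assoc A A W)) (≈-trans (∙-congʳ W AA≈I) (identityˡ W)))

module _ {M : SL₂ℤ} (iso : çark M ≅ ((çark M ᵐ) ʳ)) where
  open _≅_ iso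
  private
    open Inverse bijection using (to-cong)

    U : SL₂ℤ
    U = to I

    to-∙ : ∀ {X} → Generated X → ∀ V → to (V ∙ X) ∼[ M ] (to V ∙ X)
    to-∙ gen-S V = preserves-σ V
    to-∙ gen-R V = ∼-trans (preserves-ρ V) (≈⇒∼ (·R³ (to V ∙ R)))
    to-∙ (gen-∙ {A} {B} a b) V =
      ∼-trans (to-cong (≈⇒∼ (≈-sym (∙-assoc V A B))))
      (∼-trans (to-∙ b (V ∙ A))
      (∼-trans (∼-congʳ B (to-∙ a V))
      (≈⇒∼ (∙-assoc (to V) A B))))
    to-∙ (resp e a) V =
      ∼-trans (to-cong (≈⇒∼ (∙-congˡ V (≈-sym e)))) (∼-trans (to-∙ a V) (≈⇒∼ (∙-congˡ (to V) e)))

    to∼U∙ : ∀ W → to W ∼[ M ] (U ∙ W)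
    to∼U∙ W = ∼-trans (to-cong (≈⇒∼ (≈-sym (identityˡ W)))) (to-∙ (generated W) I)

  -- If U commuted with M it would preserve the direction of the axis.
  reciprocal⇒inverted : Hyperbolic M → ∃[ U ] Inverts U M
  -- `I` and `M` are one edge of the quotient. Comparing its images `U` and `U ∙ M` yields a power
  -- `N` of `M` with N U = U M.
  reciprocal⇒inverted hyp with ∼-trans (to-cong (by M gen (identityʳ M))) (to∼U∙ M)
  ... | by N n e with power-same-trace hyp n (∣trace∣-inter e)
  ... | inj₂ N≈M⁻¹ = U , ≈-trans (≈-sym e) (∙-congʳ U N≈M⁻¹)
  ... | inj₁ N≈M   = ⊥-elim (contradict (Equivalence.to (preserves-spine W δ) (W , a , ≈⇒∼ ≈-refl)))
    where
    ℓ : Axis M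
    ℓ = axis M hyp
    W : SL₂ℤ
    W = Axis.edge ℓ 0ℤ
    δ : Direction
    δ = Axis.dir ℓ 0ℤ
    a : OnAxis M (W , δ)
    a = ℓ , 0ℤ , ≈-refl , refl
    contradict : ¬ (∃[ V ] OnAxis M (V , opposite δ) × V ∼[ M ] to W)
    contradict (V , a′ , v) with ∼-trans v (to∼U∙ W)
    -- The edge `U ∙ W` is on the axis in direction `δ` as `U` commutes with `M`, and in the
    -- opposite one as `N′ ∙ V`.
    ... | by N′ n′ f = onAxis-unidirectional hyp
      (onAxis-translate U (≈-trans (≈-sym e) (∙-congʳ U N≈M)) a)
      (onAxis-resp f (onAxis-translate N′ (commutes-with-generator n′) a′))

proposition4p9 : (M : SL₂ℤ) (hyp : Hyperbolic M) → Reciprocal (çark M) ⇔ (∃[ f ] f ∈[ formOf M hyp ] × ReciprocalForm f)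
proposition4p9 M hyp = mk⇔ to from
  where
  S-inverts⇔ : ∀ V → Symmetric (inv V ∙ M ∙ V) ⇔ Inverts S (inv V ∙ M ∙ V)
  S-inverts⇔ V = symmetric⇔S-inverts λ tr≡0 → hyperbolic⇒trace≢0 {M} hyp
    (ℤₚ.∣i∣≡0⇒i≡0 (trans (∣trace∣-inter (inter-conjugate⁻¹ V M)) (cong ∣_∣ tr≡0)))

  to : Reciprocal (çark M) → ∃[ f ] f ∈[ formOf M hyp ] × ReciprocalForm f
  to iso with reciprocal⇒inverted iso hyp
  ... | U , inverts
    with V , u ← trace≡0⇒conjugate-S U (cong ∣_∣ (inverts-hyperbolic⇒trace≡0 hyp inverts)) =
    V · formOf M hyp , (V , refl) ,
    Equivalence.from (reciprocalForm⇔symmetric V M hyp)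
      (Equivalence.from (S-inverts⇔ V)
        (Equivalence.to (inverts-inter u (inter-conjugate⁻¹ V M)) inverts))

  from : (∃[ f ] f ∈[ formOf M hyp ] × ReciprocalForm f) → Reciprocal (çark M)
  -- The involution is V S V⁻¹: it inverts `M` because `S` inverts V⁻¹ M V.
  from (_ , (V , refl) , reciprocal) = inverting-involution⇒reciprocal
    (inter-preserves-≈ (inter-∙ a a) (inter-I V) SS≈I)
    (Equivalence.from (inverts-inter a (inter-conjugate⁻¹ V M))
      (Equivalence.to (S-inverts⇔ V)
        (Equivalence.to (reciprocalForm⇔symmetric V M hyp) reciprocal)))
    where
    a : (V ∙ S ∙ inv V) ↝[ V ] S
    a = inter-conjugate V S
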